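{- There exists an absolute constant $c>0$ such that the following holds. Let $r$ be a positive integer and let $M\in\{0,1\}^{n\times n}$ with $\operatorname{rank}(M)\leq r$ and $p(M)\leq 1/2$. Then $z(M)\geq n/2^{c\sqrt r}$.
   Context: $p(M)=|M|/n^2$, where $|M|$ is the number of $1$ entries. $z(M)$ is the largest $z$ for which there exist $X,Y\subset[n]$ with $|X|=|Y|=z$ such that the submatrix $M[X\times Y]$ (rows $X$, columns $Y$) has only $0$ entries. -}

module Defs where

open import Algebra.Properties.Monoid.Sum using (sum)
open import Data.Bool using (Bool; true; false; if_then_else_)
open import Data.Fin using (Fin)
open import Data.Fin.Subset using (Subset; _∈_; _∉_; ∣_∣)
open import Data.Integer using (+_)
open import Data.Nat using (ℕ; _*_; _^_; _≤_; NonZero)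
open import Data.Nat.Properties using (m*n≢0) renaming (+-0-monoid to ℕ-+-0-monoid)
open import Data.Product using (_×_; Σ-syntax)
open import Data.Rational as ℚ using (ℚ; 0ℚ; 1ℚ)
open import Data.Rational.Properties using () renaming (+-0-monoid to ℚ-+-0-monoid)
open import Data.Vec.Functional using (Vector)
open import Relation.Binary.PropositionalEquality using (_≡_)

sumℕ : ∀ {n} → Vector ℕ n → ℕ
sumℕ = sum ℕ-+-0-monoid

sumℚ : ∀ {n} → Vector ℚ n → ℚ
sumℚ = sum ℚ-+-0-monoid

IsGreatest : (ℕ → Set) → ℕ → Set
IsGreatest P m = P m × (∀ k → P k → k ≤ m)

-- {0,1}-matrices, with true for 1 and false for 0; the first index is the row.
BinMatrix : ℕ → Set
BinMatrix n = Fin n → Fin n → Bool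

entry : ∀ {n} → BinMatrix n → Fin n → Fin n → ℚ
entry M i j = if M i j then 1ℚ else 0ℚ

-- The rank is the real one. The entries are rational and rank does not change
-- under field extension, so linear independence is taken over ℚ.
-- The rows are a family: two equal rows with different indices in S make S
-- dependent.
RowsIndependent : ∀ {n} → BinMatrix n → Subset n → Set
RowsIndependent {n} M S =
  (a : Fin n → ℚ) →
  (∀ i → i ∉ S → a i ≡ 0ℚ) →
  (∀ j → sumℚ (λ i → a i ℚ.* entry M i j) ≡ 0ℚ) →
  ∀ i → a i ≡ 0ℚ

IsRank : ∀ {n} → BinMatrix n → ℕ → Set
IsRank {n} M =
  IsGreatest (λ k → Σ[ S ∈ Subset n ] (∣ S ∣ ≡ k × RowsIndependent M S))

ones : ∀ {n} → BinMatrix n → ℕ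
ones M = sumℕ (λ i → sumℕ (λ j → if M i j then 1 else 0))

p : ∀ {n} .{{_ : NonZero n}} → BinMatrix n → ℚ
p {n} M = ℚ._/_ (+ ones M) (n * n) {{m*n≢0 n n}}

IsZ : ∀ {n} → BinMatrix n → ℕ → Set
IsZ {n} M =
  IsGreatest (λ k → Σ[ X ∈ Subset n ] Σ[ Y ∈ Subset n ]
    (∣ X ∣ ≡ k × ∣ Y ∣ ≡ k × (∀ i j → i ∈ X → j ∈ Y → M i j ≡ false)))

-- z ≥ n / 2^(c√r) as an inequality of reals, for c ≥ 0.  By continuity of
-- x ↦ 2^x it says that n ≤ z · 2^(a/b) for every fraction a/b ≥ c√r,
-- i.e. for every a/b with c² r ≤ (a/b)²; the last line is the b-th power of
-- that inequality.
_≥_/2^[_√_] : ℕ → ℕ → ℚ → ℕ → Set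
z ≥ n /2^[ c √ r ] =
  (a b : ℕ) .{{_ : NonZero b}} →
  (c ℚ.* c) ℚ.* (+ r ℚ./ 1) ℚ.≤ (+ a ℚ./ b) ℚ.* (+ a ℚ./ b) →
  n ^ b ≤ z ^ b * 2 ^ a

{-# OPTIONS --safe #-}
module Submission where

-- A matrix of density (q/Q)², with Q a large multiple of √r, either contains a
-- sub-rectangle whose relative size 1/s is paid for by a drop of its density to
-- ((q - ⌊s⌋)/Q)², or q is at most 8. Iterating from (q/Q)² = 9/16 costs a
-- factor 2^q = 2^O(√r) in size.
--
-- For the step, let m_i be the rows, restricted to the current n columns. The
-- projection onto the row space has trace at most r, so m_ij = ⟨m_i, y_j⟩ with
-- |y_j|² ≤ 8r/n for most columns j, while |m_i|² ≤ 8(q/Q)²n for most rows i.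
-- Normalising these vectors correlates the centred matrix with its own entries
-- by a factor of order Q/(q√r), and Grothendieck's inequality turns the
-- correlation into a rectangle of discrepancy of order (q/Q)/√r.
--
-- Once (q/Q)² is small compared with 1/r, the same vectors give m_ij ≤ |m_i||y_j| < 1
-- on most rows and columns, so that m_ij = 0 there.

open import Defs
open import Data.Bool using (Bool; true; false; if_then_else_)
import Data.Bool.Properties as 𝔹ₚ
open import Data.Empty using (⊥; ⊥-elim)
open import Data.Fin using (Fin; zero; suc)
import Data.Fin.Properties as Finₚ
open import Data.Fin.Subset as Subset using (Subset; inside; outside; ∣_∣; ⁅_⁆; _∪_)
import Data.Fin.Subset.Properties as Subsetₚ
import Data.Integer as ℤ
open import Data.Integer.Tactic.RingSolver using () renaming (solve-∀ to solve-∀-ℤ)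
open import Data.List using (List; []; _∷_; _++_; map; filter; length; tabulate; allFin; take)
open import Data.List.Membership.Propositional using (_∈_)
open import Data.List.Membership.Propositional.Properties using (∈-map⁺; ∈-filter⁻; ∈-allFin)
open import Data.List.Properties using (length-map; length-take; length-tabulate)
open import Data.List.Relation.Binary.Sublist.Propositional using (_⊆_; ⊆-refl; ⊆-trans; []; _∷_; _∷ʳ_; lookup)
open import Data.List.Relation.Binary.Sublist.Propositional.Properties using (filter-⊆; length-mono-≤; take-⊆)
open import Data.List.Relation.Unary.Any using (here; there)
open import Data.Nat as ℕ using (ℕ; zero; suc)
open import Data.Nat.DivMod using (m/n*n≤m; m≡m%n+[m/n]*n; m%n<n; m≥n⇒m/n>0)
open import Data.Nat.Induction using (<-rec)
open import Data.Nat.ListAction using (sum)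
import Data.Nat.Properties as ℕₚ
open import Data.Nat.Tactic.RingSolver using () renaming (solve-∀ to solve-∀-ℕ)
open import Data.Product using (_×_; _,_; proj₁; proj₂; Σ-syntax; ∃-syntax)
open import Data.Rational as ℚ using (ℚ; 0ℚ; 1ℚ; ½; _+_; _*_; _-_; -_; _≤_; _<_; 1/_; nonNegative; positive; ≢-nonZero)
open import Data.Rational.Properties
import Data.Rational.Unnormalised as ℚᵘ
import Data.Rational.Unnormalised.Properties as ℚᵘₚ
open import Data.Sum using (_⊎_; inj₁; inj₂)
open import Data.Vec using ([]; _∷_; here; there)
open import Function using (_∘_)
open import Level using (0ℓ)
open import Relation.Binary.PropositionalEquality
open import Relation.Nullary using (¬_; Dec; yes; no)
open import Relation.Nullary.Decidable using (dec⇒maybe; ¬?; _×-dec_; _→-dec_)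
open import Relation.Unary using (Pred; Decidable)
open import Tactic.RingSolver using (solve-∀)
open import Tactic.RingSolver.Core.AlmostCommutativeRing using (AlmostCommutativeRing; fromCommutativeRing)

-- The exponent is free of a logarithm because progress is measured by the square root of the
-- density p. A discrepancy of order √p/√r lowers √p by order 1/√r whatever p is, so all the drops
-- together amount to O(√r). With p = (q/Q)² this is the identity (q - ℓ)² = q² - 2qℓ + ℓ²: a
-- discrepancy of 2q, in units of 1/Q², pays for one unit of q, and if it sits on a sub-rectangle ℓ
-- times smaller it pays for ℓ units, while ℓ < 2^ℓ bounds the loss of area by a factor 2 per unit.
--
-- The obstacle is that all computations are rational. The roots √n and √r enter only through
-- integers that approximate them within a factor 2, and inequalities between norms are replaced by
-- nonnegativity of suitable squares. Grothendieck's inequality is obtained from random signs, for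
-- which second and fourth moments suffice. In place of a supremum that bounds itself, the rounding
-- is iterated until the remaining error is below one unit.
--
-- The rectangles found on the way need not be square, so the induction bounds areas; only an
-- all-zero rectangle at the very end is compared with z.

private variable A B : Set

-- Ordered-field arithmetic in ℚ

ℚ-ring : AlmostCommutativeRing 0ℓ 0ℓ
ℚ-ring = fromCommutativeRing +-*-commutativeRing (λ x → dec⇒maybe (0ℚ ≟ x))

≤-by : ∀ {p q} d → 0ℚ ≤ d → p + d ≡ q → p ≤ q
≤-by {p} {q} d 0≤d eq = subst₂ _≤_ (+-identityʳ p) eq (+-monoʳ-≤ p 0≤d)

≤⇒0≤- : ∀ {p q} → p ≤ q → 0ℚ ≤ q - p
≤⇒0≤- {p} {q} p≤q = subst (_≤ q - p) (+-inverseʳ p) (+-monoˡ-≤ (- p) p≤q)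

0≤+ : ∀ {p q} → 0ℚ ≤ p → 0ℚ ≤ q → 0ℚ ≤ p + q
0≤+ {p} {q} a b = subst (_≤ p + q) (+-identityʳ 0ℚ) (+-mono-≤ a b)

0≤* : ∀ {p q} → 0ℚ ≤ p → 0ℚ ≤ q → 0ℚ ≤ p * q
0≤* {p} {q} a b = subst (_≤ p * q) (*-zeroʳ p) (*-monoˡ-≤-nonNeg p {{nonNegative a}} b)

private
  neg² : ∀ p → (0ℚ - p) * (0ℚ - p) ≡ p * p
  neg² = solve-∀ ℚ-ring

0≤² : ∀ p → 0ℚ ≤ p * p
0≤² p with ≤-total 0ℚ p
... | inj₁ 0≤p = 0≤* 0≤p 0≤p
... | inj₂ p≤0 = subst (0ℚ ≤_) (neg² p) (0≤* (≤⇒0≤- p≤0) (≤⇒0≤- p≤0))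

*-monoˡ : ∀ {c p q} → 0ℚ ≤ c → p ≤ q → c * p ≤ c * q
*-monoˡ {c} 0≤c = *-monoˡ-≤-nonNeg c {{nonNegative 0≤c}}

*-cancelˡ-≤ : ∀ {c p q} → 0ℚ < c → c * p ≤ c * q → p ≤ q
*-cancelˡ-≤ {c} 0<c = *-cancelˡ-≤-pos c {{positive 0<c}}

≤∧≢⇒< : ∀ {p q} → p ≤ q → p ≢ q → p < q
≤∧≢⇒< p≤q p≢q = ≰⇒> (λ q≤p → p≢q (≤-antisym p≤q q≤p))

0<* : ∀ {p q} → 0ℚ < p → 0ℚ < q → 0ℚ < p * q
0<* {p} {q} 0<p 0<q = subst (_< p * q) (*-zeroʳ p) (*-monoʳ-<-pos p {{positive 0<p}} 0<q)

recip : ∀ p → p ≢ 0ℚ → ∃[ q ] p * q ≡ 1ℚ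
recip p p≢0 = (1/ p) {{≢-nonZero p≢0}} , *-inverseʳ p {{≢-nonZero p≢0}}

0≤1 : 0ℚ ≤ 1ℚ
0≤1 = 0≤² 1ℚ

*-zero-divisor : ∀ {p q} → p * q ≡ 0ℚ → p ≢ 0ℚ → q ≡ 0ℚ
*-zero-divisor {p} {q} pq≡0 p≢0 with recip p p≢0
... | r , pr≡1 = begin
  q             ≡⟨ *-identityˡ q ⟨
  1ℚ * q        ≡⟨ cong (_* q) pr≡1 ⟨
  p * r * q     ≡⟨ perm p r q ⟩
  r * (p * q)   ≡⟨ cong (r *_) pq≡0 ⟩
  r * 0ℚ        ≡⟨ *-zeroʳ r ⟩
  0ℚ            ∎
  where
  open ≡-Reasoning
  perm : ∀ p r q → p * r * q ≡ r * (p * q)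
  perm = solve-∀ ℚ-ring

ι : ℕ → ℚ
ι zero    = 0ℚ
ι (suc n) = 1ℚ + ι n

0≤ι : ∀ n → 0ℚ ≤ ι n
0≤ι zero    = ≤-refl
0≤ι (suc n) = 0≤+ 0≤1 (0≤ι n)

ι-+ : ∀ m n → ι (m ℕ.+ n) ≡ ι m + ι n
ι-+ zero    n = sym (+-identityˡ (ι n))
ι-+ (suc m) n = trans (cong (1ℚ +_) (ι-+ m n)) (sym (+-assoc 1ℚ (ι m) (ι n)))

ι-* : ∀ m n → ι (m ℕ.* n) ≡ ι m * ι n
ι-* zero    n = sym (*-zeroˡ (ι n))
ι-* (suc m) n = trans (ι-+ n (m ℕ.* n)) (trans (cong (ι n +_) (ι-* m n)) (expand (ι m) (ι n)))
  where
  expand : ∀ a b → b + a * b ≡ (1ℚ + a) * b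
  expand = solve-∀ ℚ-ring

ι-mono-≤ : ∀ {m n} → m ℕ.≤ n → ι m ≤ ι n
ι-mono-≤ {n = n} ℕ.z≤n = 0≤ι n
ι-mono-≤ (ℕ.s≤s m≤n)   = +-monoʳ-≤ 1ℚ (ι-mono-≤ m≤n)

private
  0<1 : 0ℚ < 1ℚ
  0<1 = ≤∧≢⇒< 0≤1 (λ ())

0<ι : ∀ n .{{_ : ℕ.NonZero n}} → 0ℚ < ι n
0<ι (suc n) = <-≤-trans 0<1 (≤-by (ι n) (0≤ι n) refl)

-- Sums over lists

S : List A → (A → ℚ) → ℚ
S []      f = 0ℚ
S (x ∷ l) f = f x + S l f

S-cong : ∀ (l : List A) {f g} → (∀ {x} → x ∈ l → f x ≡ g x) → S l f ≡ S l g
S-cong []      eq = refl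
S-cong (x ∷ l) eq = cong₂ _+_ (eq (here refl)) (S-cong l (eq ∘ there))

S-mono : ∀ (l : List A) {f g} → (∀ {x} → x ∈ l → f x ≤ g x) → S l f ≤ S l g
S-mono []      le = ≤-refl
S-mono (x ∷ l) le = +-mono-≤ (le (here refl)) (S-mono l (le ∘ there))

S-nonneg : ∀ (l : List A) {f} → (∀ x → 0ℚ ≤ f x) → 0ℚ ≤ S l f
S-nonneg []      nn = ≤-refl
S-nonneg (x ∷ l) nn = 0≤+ (nn x) (S-nonneg l nn)

S-+* : ∀ (l : List A) f c g → S l (λ x → f x + c * g x) ≡ S l f + c * S l g
S-+* []      f c g = sym (trans (+-identityˡ _) (*-zeroʳ c))
S-+* (x ∷ l) f c g = trans (cong (f x + c * g x +_) (S-+* l f c g)) (regroup (f x) c (g x) (S l f) (S l g))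
  where
  regroup : ∀ a c b s t → a + c * b + (s + c * t) ≡ a + s + c * (b + t)
  regroup = solve-∀ ℚ-ring

S-+ : ∀ (l : List A) f g → S l (λ x → f x + g x) ≡ S l f + S l g
S-+ l f g = trans (S-cong l (λ {x} _ → cong (f x +_) (sym (*-identityˡ (g x)))))
  (trans (S-+* l f 1ℚ g) (cong (S l f +_) (*-identityˡ _)))

S-0 : ∀ (l : List A) → S l (λ _ → 0ℚ) ≡ 0ℚ
S-0 []      = refl
S-0 (_ ∷ l) = trans (+-identityˡ _) (S-0 l)

S-*ˡ : ∀ (l : List A) c f → S l (λ x → c * f x) ≡ c * S l f
S-*ˡ l c f = trans (S-cong l (λ _ → sym (+-identityˡ _)))
  (trans (S-+* l (λ _ → 0ℚ) c f) (trans (cong (_+ c * S l f) (S-0 l)) (+-identityˡ _)))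

S-*ʳ : ∀ (l : List A) c f → S l (λ x → f x * c) ≡ S l f * c
S-*ʳ l c f = trans (S-cong l (λ {x} _ → *-comm (f x) c)) (trans (S-*ˡ l c f) (*-comm c _))

S-const : ∀ (l : List A) c → S l (λ _ → c) ≡ ι (length l) * c
S-const []      c = sym (*-zeroˡ c)
S-const (_ ∷ l) c = trans (cong (c +_) (S-const l c)) (expand c (ι (length l)))
  where
  expand : ∀ c a → c + a * c ≡ (1ℚ + a) * c
  expand = solve-∀ ℚ-ring

S-swap : ∀ (k : List A) (l : List B) (f : A → B → ℚ) →
  S k (λ x → S l (λ y → f x y)) ≡ S l (λ y → S k (λ x → f x y))
S-swap []      l f = sym (S-0 l)
S-swap (x ∷ k) l f = trans (cong (S l (f x) +_) (S-swap k l f)) (sym (S-+ l (f x) _))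

S-++ : ∀ (k l : List A) f → S (k ++ l) f ≡ S k f + S l f
S-++ []      l f = sym (+-identityˡ _)
S-++ (x ∷ k) l f = trans (cong (f x +_) (S-++ k l f)) (sym (+-assoc (f x) _ _))

S-map : ∀ (g : A → B) (l : List A) f → S (map g l) f ≡ S l (f ∘ g)
S-map g []      f = refl
S-map g (x ∷ l) f = cong (f (g x) +_) (S-map g l f)

𝟙 : ∀ {P : Set} → Dec P → ℚ
𝟙 (yes _) = 1ℚ
𝟙 (no  _) = 0ℚ

S-filter : ∀ {P : Pred A 0ℓ} (P? : Decidable P) (l : List A) f →
  S (filter P? l) f ≡ S l (λ x → 𝟙 (P? x) * f x)
S-filter P? []      f = refl
S-filter P? (x ∷ l) f with P? x
... | yes _ = cong₂ _+_ (sym (*-identityˡ (f x))) (S-filter P? l f)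
... | no  _ = trans (S-filter P? l f) (sym (trans (cong (_+ _) (*-zeroˡ (f x))) (+-identityˡ _)))

S-zero : ∀ (l : List A) {f} → (∀ x → 0ℚ ≤ f x) → S l f ≡ 0ℚ → ∀ {x} → x ∈ l → f x ≡ 0ℚ
S-zero (x ∷ l) {f} nn eq (here refl) =
  ≤-antisym (subst (f x ≤_) eq (≤-by _ (S-nonneg l nn) refl)) (nn x)
S-zero (x ∷ l) {f} nn eq (there x∈l) = S-zero l nn
  (≤-antisym (subst (S l f ≤_) eq (≤-by _ (nn x) (+-comm _ (f x)))) (S-nonneg l nn)) x∈l

-- Inner products and leverage vectors

module Dot (L : List A) where

  ⟨_,_⟩ : (A → ℚ) → (A → ℚ) → ℚ
  ⟨ f , g ⟩ = S L (λ x → f x * g x)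

  ⟨⟩-comm : ∀ f g → ⟨ f , g ⟩ ≡ ⟨ g , f ⟩
  ⟨⟩-comm f g = S-cong L (λ {x} _ → *-comm (f x) (g x))

  ⟨⟩-linʳ : ∀ f g c h → ⟨ f , (λ x → g x + c * h x) ⟩ ≡ ⟨ f , g ⟩ + c * ⟨ f , h ⟩
  ⟨⟩-linʳ f g c h = trans (S-cong L (λ {x} _ → distr (f x) (g x) c (h x)))
    (S-+* L (λ x → f x * g x) c (λ x → f x * h x))
    where
    distr : ∀ f g c h → f * (g + c * h) ≡ f * g + c * (f * h)
    distr = solve-∀ ℚ-ring

  ⟨⟩-linˡ : ∀ g c h f → ⟨ (λ x → g x + c * h x) , f ⟩ ≡ ⟨ g , f ⟩ + c * ⟨ h , f ⟩
  ⟨⟩-linˡ g c h f = trans (⟨⟩-comm _ f)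
    (trans (⟨⟩-linʳ f g c h) (cong₂ (λ a b → a + c * b) (⟨⟩-comm f g) (⟨⟩-comm f h)))

  ⟨⟩-nonneg : ∀ f → 0ℚ ≤ ⟨ f , f ⟩
  ⟨⟩-nonneg f = S-nonneg L (λ x → 0≤² (f x))

  ⟨⟩-definite : ∀ f → ⟨ f , f ⟩ ≡ 0ℚ → ∀ {x} → x ∈ L → f x ≡ 0ℚ
  ⟨⟩-definite f eq {x} x∈L with f x ≟ 0ℚ
  ... | yes fx≡0 = fx≡0
  ... | no  fx≢0 = *-zero-divisor (S-zero L (λ y → 0≤² (f y)) eq x∈L) fx≢0

  0+c*0 : ∀ c → 0ℚ + c * 0ℚ ≡ 0ℚ
  0+c*0 = solve-∀ ℚ-ring

  ⟨⟩-zeroʳ : ∀ f → ⟨ f , (λ _ → 0ℚ) ⟩ ≡ 0ℚ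
  ⟨⟩-zeroʳ f = trans (S-cong L (λ {x} _ → *-zeroʳ (f x))) (S-0 L)

  -- `y` is the reproducing kernel of the span of the `V k`: when `L` has no repetitions, `y j` is
  -- the orthogonal projection of the `j`-th unit vector, and the squared norms add up to the
  -- dimension. `in-span` states membership in the span dually, which is the form that the induction
  -- consumes.
  record Leverage {K : Set} (ks : List K) (V : K → A → ℚ) : Set where
    field
      y          : A → A → ℚ
      reproduces : ∀ {k} → k ∈ ks → ∀ {j} → j ∈ L → ⟨ V k , y j ⟩ ≡ V k j
      trace      : S L (λ j → ⟨ y j , y j ⟩) ≤ ι (length ks)
      in-span    : ∀ w → (∀ {k} → k ∈ ks → ⟨ w , V k ⟩ ≡ 0ℚ) → ∀ j → ⟨ w , y j ⟩ ≡ 0ℚ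

  -- The first vector is projected off the others, so that its own
  -- contribution v(j) v / ⟨v,v⟩ to y_j is orthogonal to the rest and adds
  -- exactly 1 to the trace.
  leverage : ∀ {K : Set} (ks : List K) V → Leverage ks V
  leverage [] V = record
    { y = λ _ _ → 0ℚ
    ; reproduces = λ ()
    ; trace = ≤-reflexive (trans (S-cong L (λ _ → ⟨⟩-zeroʳ (λ _ → 0ℚ))) (S-0 L))
    ; in-span = λ w _ _ → ⟨⟩-zeroʳ w
    }
  leverage {K} (k₀ ∷ ks) V with ⟨ V k₀ , V k₀ ⟩ ≟ 0ℚ
  ... | yes vv≡0 = record
    { y = y
    ; reproduces = λ where
        (here refl) {j} j∈L → trans
          (trans (S-cong L (λ {x} x∈L → trans (cong (_* y j x) (v≡0 x∈L)) (*-zeroˡ (y j x)))) (S-0 L))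
          (sym (v≡0 j∈L))
        (there k∈) → reproduces k∈
    ; trace = ≤-trans trace (≤-by 1ℚ 0≤1 (+-comm (ι (length ks)) 1ℚ))
    ; in-span = λ w w⟂ → in-span w (λ k∈ → w⟂ (there k∈))
    }
    where
    open Leverage (leverage ks V)
    v≡0 : ∀ {x} → x ∈ L → V k₀ x ≡ 0ℚ
    v≡0 = ⟨⟩-definite (V k₀) vv≡0
  ... | no vv≢0 = record
    { y = y′
    ; reproduces = reproduces′
    ; trace = trace′
    ; in-span = λ w w⟂ j → begin
        ⟨ w , y′ j ⟩                                 ≡⟨ ⟨⟩-linʳ w (y j) (v j * β⁻¹) v ⟩
        ⟨ w , y j ⟩ + v j * β⁻¹ * ⟨ w , v ⟩          ≡⟨ cong₂ (λ a b → a + v j * β⁻¹ * b)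
                                                          (in-span w (w⟂pr w w⟂) j) (w⟂ (here refl)) ⟩
        0ℚ + v j * β⁻¹ * 0ℚ                          ≡⟨ 0+c*0 (v j * β⁻¹) ⟩
        0ℚ                                           ∎
    }
    where
    open ≡-Reasoning
    v : A → ℚ
    v = V k₀
    β β⁻¹ : ℚ
    β = ⟨ v , v ⟩
    β⁻¹ = proj₁ (recip β vv≢0)
    ββ⁻¹≡1 : β * β⁻¹ ≡ 1ℚ
    ββ⁻¹≡1 = proj₂ (recip β vv≢0)
    coef : K → ℚ
    coef k = - (⟨ v , V k ⟩ * β⁻¹)
    pr : K → A → ℚ
    pr k x = V k x + coef k * v x

    open Leverage (leverage ks pr)

    y′ : A → A → ℚ
    y′ j x = y j x + v j * β⁻¹ * v x

    w⟂pr : ∀ w → (∀ {k} → k ∈ k₀ ∷ ks → ⟨ w , V k ⟩ ≡ 0ℚ) → ∀ {k} → k ∈ ks → ⟨ w , pr k ⟩ ≡ 0ℚ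
    w⟂pr w w⟂ {k} k∈ = begin
      ⟨ w , pr k ⟩                       ≡⟨ ⟨⟩-linʳ w (V k) (coef k) v ⟩
      ⟨ w , V k ⟩ + coef k * ⟨ w , v ⟩   ≡⟨ cong₂ (λ a b → a + coef k * b) (w⟂ (there k∈)) (w⟂ (here refl)) ⟩
      0ℚ + coef k * 0ℚ                   ≡⟨ 0+c*0 (coef k) ⟩
      0ℚ                                 ∎

    v⟂pr : ∀ k → ⟨ v , pr k ⟩ ≡ 0ℚ
    v⟂pr k = begin
      ⟨ v , pr k ⟩                              ≡⟨ ⟨⟩-linʳ v (V k) (coef k) v ⟩
      ⟨ v , V k ⟩ + - (⟨ v , V k ⟩ * β⁻¹) * β   ≡⟨ factor ⟨ v , V k ⟩ β⁻¹ β ⟩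
      ⟨ v , V k ⟩ * (1ℚ - β * β⁻¹)              ≡⟨ cong (λ t → ⟨ v , V k ⟩ * (1ℚ - t)) ββ⁻¹≡1 ⟩
      ⟨ v , V k ⟩ * (1ℚ - 1ℚ)                   ≡⟨ *-zeroʳ ⟨ v , V k ⟩ ⟩
      0ℚ                                        ∎
      where
      factor : ∀ a i b → a + - (a * i) * b ≡ a * (1ℚ - b * i)
      factor = solve-∀ ℚ-ring

    v⟂y : ∀ j → ⟨ v , y j ⟩ ≡ 0ℚ
    v⟂y = in-span v (λ {k} _ → v⟂pr k)

    v-reproduced : ∀ j → ⟨ v , y′ j ⟩ ≡ v j
    v-reproduced j = begin
      ⟨ v , y′ j ⟩                           ≡⟨ ⟨⟩-linʳ v (y j) (v j * β⁻¹) v ⟩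
      ⟨ v , y j ⟩ + v j * β⁻¹ * β            ≡⟨ cong (_+ v j * β⁻¹ * β) (v⟂y j) ⟩
      0ℚ + v j * β⁻¹ * β                     ≡⟨ factor (v j) β⁻¹ β ⟩
      v j * (β * β⁻¹)                        ≡⟨ cong (v j *_) ββ⁻¹≡1 ⟩
      v j * 1ℚ                               ≡⟨ *-identityʳ (v j) ⟩
      v j                                    ∎
      where
      factor : ∀ a i b → 0ℚ + a * i * b ≡ a * (b * i)
      factor = solve-∀ ℚ-ring

    cancel : ∀ a c b → a + c * b - c * b ≡ a
    cancel = solve-∀ ℚ-ring

    reproduces′ : ∀ {k} → k ∈ k₀ ∷ ks → ∀ {j} → j ∈ L → ⟨ V k , y′ j ⟩ ≡ V k j
    reproduces′ (here refl) {j} _ = v-reproduced j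
    reproduces′ {k} (there k∈) {j} j∈L = begin
      ⟨ V k , y′ j ⟩                                       ≡⟨ cancel ⟨ V k , y′ j ⟩ (coef k) ⟨ v , y′ j ⟩ ⟨
      ⟨ V k , y′ j ⟩ + coef k * ⟨ v , y′ j ⟩ - coef k * ⟨ v , y′ j ⟩
        ≡⟨ cong₂ (λ a b → a - coef k * b) (sym (⟨⟩-linˡ (V k) (coef k) v (y′ j))) (v-reproduced j) ⟩
      ⟨ pr k , y′ j ⟩ - coef k * v j                       ≡⟨ cong (_- coef k * v j) pr-reproduced ⟩
      pr k j - coef k * v j                                ≡⟨ cancel (V k j) (coef k) (v j) ⟩
      V k j                                                ∎
      where
      x+c*0 : ∀ a c → a + c * 0ℚ ≡ a
      x+c*0 = solve-∀ ℚ-ring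
      pr-reproduced : ⟨ pr k , y′ j ⟩ ≡ pr k j
      pr-reproduced = begin
        ⟨ pr k , y′ j ⟩                                    ≡⟨ ⟨⟩-linʳ (pr k) (y j) (v j * β⁻¹) v ⟩
        ⟨ pr k , y j ⟩ + v j * β⁻¹ * ⟨ pr k , v ⟩
          ≡⟨ cong₂ (λ a b → a + v j * β⁻¹ * b) (reproduces k∈ j∈L) (trans (⟨⟩-comm (pr k) v) (v⟂pr k)) ⟩
        pr k j + v j * β⁻¹ * 0ℚ                            ≡⟨ x+c*0 (pr k j) (v j * β⁻¹) ⟩
        pr k j                                             ∎

    norm′ : ∀ j → ⟨ y′ j , y′ j ⟩ ≡ ⟨ y j , y j ⟩ + β⁻¹ * (v j * v j)
    norm′ j = begin
      ⟨ y′ j , y′ j ⟩                                        ≡⟨ ⟨⟩-linʳ (y′ j) (y j) (v j * β⁻¹) v ⟩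
      ⟨ y′ j , y j ⟩ + v j * β⁻¹ * ⟨ y′ j , v ⟩              ≡⟨ cong₂ (λ a b → a + v j * β⁻¹ * b)
                                                                 (⟨⟩-linˡ (y j) (v j * β⁻¹) v (y j))
                                                                 (trans (⟨⟩-comm (y′ j) v) (v-reproduced j)) ⟩
      ⟨ y j , y j ⟩ + v j * β⁻¹ * ⟨ v , y j ⟩ + v j * β⁻¹ * v j
        ≡⟨ cong (λ a → ⟨ y j , y j ⟩ + v j * β⁻¹ * a + v j * β⁻¹ * v j) (v⟂y j) ⟩
      ⟨ y j , y j ⟩ + v j * β⁻¹ * 0ℚ + v j * β⁻¹ * v j       ≡⟨ tidy ⟨ y j , y j ⟩ (v j) β⁻¹ ⟩
      ⟨ y j , y j ⟩ + β⁻¹ * (v j * v j)                      ∎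
      where
      tidy : ∀ n a i → n + a * i * 0ℚ + a * i * a ≡ n + i * (a * a)
      tidy = solve-∀ ℚ-ring

    trace′ : S L (λ j → ⟨ y′ j , y′ j ⟩) ≤ 1ℚ + ι (length ks)
    trace′ = subst₂ _≤_ (sym total) (+-comm (ι (length ks)) 1ℚ) (+-monoˡ-≤ 1ℚ trace)
      where
      N : A → ℚ
      N j = ⟨ y j , y j ⟩
      total : S L (λ j → ⟨ y′ j , y′ j ⟩) ≡ S L N + 1ℚ
      total = begin
        S L (λ j → ⟨ y′ j , y′ j ⟩)              ≡⟨ S-cong L (λ {j} _ → norm′ j) ⟩
        S L (λ j → N j + β⁻¹ * (v j * v j))      ≡⟨ S-+* L N β⁻¹ (λ j → v j * v j) ⟩
        S L N + β⁻¹ * β                          ≡⟨ cong (S L N +_) (trans (*-comm β⁻¹ β) ββ⁻¹≡1) ⟩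
        S L N + 1ℚ                               ∎

-- Linear spans and separating functionals

data Span {A K : Set} (V : K → A → ℚ) : List K → (A → ℚ) → Set where
  nil  : ∀ {w} → (∀ x → w x ≡ 0ℚ) → Span V [] w
  cons : ∀ {k ks w} c → Span V ks (λ x → w x + c * V k x) → Span V (k ∷ ks) w

Span-resp : ∀ {K : Set} {V : K → A → ℚ} {ks w w′} → (∀ x → w x ≡ w′ x) → Span V ks w → Span V ks w′
Span-resp eq (nil w≡0) = nil (λ x → trans (sym (eq x)) (w≡0 x))
Span-resp {V = V} {k ∷ _} eq (cons c s) = cons c (Span-resp (λ x → cong (_+ c * V k x) (eq x)) s)

module Fredholm (L : List A) (full : ∀ x → x ∈ L) {K : Set} (V : K → A → ℚ) where
  open Dot L

  -- If φ separates `w` from `ks` but does not kill v = `V k₀`, subtract from `w` the multiple of v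
  -- that brings φ to 0 and ask again. A new functional φ′ is corrected by a multiple of φ so as to
  -- kill v; its value on `w` is then the value of φ′ on the reduced vector.
  span-or-separated : ∀ ks w → Span V ks w ⊎
    ∃[ φ ] ((∀ {k} → k ∈ ks → ⟨ φ , V k ⟩ ≡ 0ℚ) × ⟨ φ , w ⟩ ≢ 0ℚ)
  span-or-separated [] w with ⟨ w , w ⟩ ≟ 0ℚ
  ... | yes ww≡0 = inj₁ (nil (λ x → ⟨⟩-definite w ww≡0 (full x)))
  ... | no  ww≢0 = inj₂ (w , (λ ()) , ww≢0)
  span-or-separated (k₀ ∷ ks) w with span-or-separated ks w
  ... | inj₁ w∈ = inj₁ (cons 0ℚ (Span-resp (λ x → sym (x+0* (w x) (V k₀ x))) w∈))
    where
    x+0* : ∀ a b → a + 0ℚ * b ≡ a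
    x+0* = solve-∀ ℚ-ring
  ... | inj₂ (φ , φ⟂ , φw≢0) with ⟨ φ , V k₀ ⟩ ≟ 0ℚ
  ...   | yes φv≡0 = inj₂ (φ , (λ { (here refl) → φv≡0 ; (there k∈) → φ⟂ k∈ }) , φw≢0)
  ...   | no  φv≢0 with recip ⟨ φ , V k₀ ⟩ φv≢0
  ...     | i , φv*i≡1 with span-or-separated ks (λ x → w x + - (⟨ φ , w ⟩ * i) * V k₀ x)
  ...       | inj₁ w′∈ = inj₁ (cons (- (⟨ φ , w ⟩ * i)) w′∈)
  ...       | inj₂ (φ′ , φ′⟂ , φ′w′≢0) = inj₂ (φ″ , φ″⟂ , φ″w≢0)
    where
    open ≡-Reasoning
    v : A → ℚ
    v = V k₀
    γ : ℚ
    γ = - (⟨ φ′ , v ⟩ * i)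
    φ″ : A → ℚ
    φ″ x = φ′ x + γ * φ x
    φ″⟂ : ∀ {k} → k ∈ k₀ ∷ ks → ⟨ φ″ , V k ⟩ ≡ 0ℚ
    φ″⟂ (here refl) = begin
      ⟨ φ″ , v ⟩                                              ≡⟨ ⟨⟩-linˡ φ′ γ φ v ⟩
      ⟨ φ′ , v ⟩ + - (⟨ φ′ , v ⟩ * i) * ⟨ φ , v ⟩             ≡⟨ factor ⟨ φ′ , v ⟩ i ⟨ φ , v ⟩ ⟩
      ⟨ φ′ , v ⟩ * (1ℚ - ⟨ φ , v ⟩ * i)                       ≡⟨ cong (λ t → ⟨ φ′ , v ⟩ * (1ℚ - t)) φv*i≡1 ⟩
      ⟨ φ′ , v ⟩ * 0ℚ                                         ≡⟨ *-zeroʳ ⟨ φ′ , v ⟩ ⟩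
      0ℚ                                                      ∎
      where
      factor : ∀ a i b → a + - (a * i) * b ≡ a * (1ℚ - b * i)
      factor = solve-∀ ℚ-ring
    φ″⟂ {k} (there k∈) = trans (⟨⟩-linˡ φ′ γ φ (V k))
      (trans (cong₂ (λ a b → a + γ * b) (φ′⟂ k∈) (φ⟂ k∈)) (0+c*0 γ))
    φ″w≢0 : ⟨ φ″ , w ⟩ ≢ 0ℚ
    φ″w≢0 φ″w≡0 = φ′w′≢0 (begin
      ⟨ φ′ , (λ x → w x + - (⟨ φ , w ⟩ * i) * v x) ⟩          ≡⟨ ⟨⟩-linʳ φ′ w (- (⟨ φ , w ⟩ * i)) v ⟩
      ⟨ φ′ , w ⟩ + - (⟨ φ , w ⟩ * i) * ⟨ φ′ , v ⟩             ≡⟨ exchange ⟨ φ′ , w ⟩ ⟨ φ , w ⟩ i ⟨ φ′ , v ⟩ ⟩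
      ⟨ φ′ , w ⟩ + γ * ⟨ φ , w ⟩                              ≡⟨ ⟨⟩-linˡ φ′ γ φ w ⟨
      ⟨ φ″ , w ⟩                                              ≡⟨ φ″w≡0 ⟩
      0ℚ                                                      ∎)
      where
      exchange : ∀ a b i c → a + - (b * i) * c ≡ a + - (c * i) * b
      exchange = solve-∀ ℚ-ring

-- Expectation over uniformly random signs

E : ℕ → (List Bool → ℚ) → ℚ
E zero    g = g []
E (suc d) g = ½ * (E d (g ∘ (true ∷_)) + E d (g ∘ (false ∷_)))

0≤½ : 0ℚ ≤ ½
0≤½ = nonNegative⁻¹ ½

E-cong : ∀ d {g h} → (∀ ω → g ω ≡ h ω) → E d g ≡ E d h
E-cong zero    eq = eq []
E-cong (suc d) eq = cong₂ (λ s t → ½ * (s + t)) (E-cong d (eq ∘ (true ∷_))) (E-cong d (eq ∘ (false ∷_)))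

E-mono : ∀ d {g h} → (∀ ω → g ω ≤ h ω) → E d g ≤ E d h
E-mono zero    le = le []
E-mono (suc d) le = *-monoˡ 0≤½ (+-mono-≤ (E-mono d (le ∘ (true ∷_))) (E-mono d (le ∘ (false ∷_))))

E-const : ∀ d c → E d (λ _ → c) ≡ c
E-const zero    c = refl
E-const (suc d) c = trans (cong₂ (λ s t → ½ * (s + t)) (E-const d c) (E-const d c)) (halves c)
  where
  halves : ∀ c → ½ * (c + c) ≡ c
  halves = solve-∀ ℚ-ring

E-+* : ∀ d g c h → E d (λ ω → g ω + c * h ω) ≡ E d g + c * E d h
E-+* zero    g c h = refl
E-+* (suc d) g c h = trans
  (cong₂ (λ s t → ½ * (s + t)) (E-+* d (g ∘ (true ∷_)) c (h ∘ (true ∷_))) (E-+* d (g ∘ (false ∷_)) c (h ∘ (false ∷_))))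
  (regroup (E d (g ∘ (true ∷_))) (E d (g ∘ (false ∷_))) c (E d (h ∘ (true ∷_))) (E d (h ∘ (false ∷_))))
  where
  regroup : ∀ s t c u v → ½ * (s + c * u + (t + c * v)) ≡ ½ * (s + t) + c * (½ * (u + v))
  regroup = solve-∀ ℚ-ring

E-* : ∀ d c h → E d (λ ω → c * h ω) ≡ c * E d h
E-* d c h = trans (E-cong d (λ ω → sym (+-identityˡ (c * h ω))))
  (trans (E-+* d (λ _ → 0ℚ) c h) (trans (cong (_+ c * E d h) (E-const d 0ℚ)) (+-identityˡ (c * E d h))))

E-+ : ∀ d g h → E d (λ ω → g ω + h ω) ≡ E d g + E d h
E-+ d g h = trans (E-cong d (λ ω → cong (_+_ (g ω)) (sym (*-identityˡ (h ω)))))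
  (trans (E-+* d g 1ℚ h) (cong (E d g +_) (*-identityˡ (E d h))))

E-S : ∀ d (l : List A) (f : A → List Bool → ℚ) → E d (λ ω → S l (λ x → f x ω)) ≡ S l (λ x → E d (f x))
E-S d []      f = E-const d 0ℚ
E-S d (x ∷ l) f = trans (E-+ d (f x) (λ ω → S l (λ x → f x ω))) (cong (E d (f x) +_) (E-S d l f))

-- Each sign is listed twice, which makes the weight 4⁻ᵈ of a point a square.
E-as-S : ∀ d → Σ[ L ∈ List (List Bool) ] ∃[ c ] (∀ g → c * c * S L g ≡ E d g)
E-as-S zero    = [] ∷ [] , 1ℚ , λ g → unit (g [])
  where
  unit : ∀ a → 1ℚ * 1ℚ * (a + 0ℚ) ≡ a
  unit = solve-∀ ℚ-ring
E-as-S (suc d) with E-as-S d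
... | L , c , eq = t ++ f ++ t ++ f , ½ * c , λ g → begin
  ½ * c * (½ * c) * S (t ++ f ++ t ++ f) g                 ≡⟨ cong (½ * c * (½ * c) *_) (split g) ⟩
  ½ * c * (½ * c) * (T g + (F g + (T g + F g)))            ≡⟨ regroup c (T g) (F g) ⟩
  ½ * (c * c * T g + c * c * F g)                          ≡⟨ cong₂ (λ s t → ½ * (s + t)) (eq (g ∘ (true ∷_))) (eq (g ∘ (false ∷_))) ⟩
  E (suc d) g                                              ∎
  where
  open ≡-Reasoning
  t f : List (List Bool)
  t = map (true ∷_) L
  f = map (false ∷_) L
  T F : (List Bool → ℚ) → ℚ
  T g = S L (g ∘ (true ∷_))
  F g = S L (g ∘ (false ∷_))
  split : ∀ g → S (t ++ f ++ t ++ f) g ≡ T g + (F g + (T g + F g))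
  split g = trans (S-++ t (f ++ t ++ f) g) (cong₂ _+_ (S-map _ L g)
    (trans (S-++ f (t ++ f) g) (cong₂ _+_ (S-map _ L g)
      (trans (S-++ t f g) (cong₂ _+_ (S-map _ L g) (S-map _ L g))))))
  regroup : ∀ c t f → ½ * c * (½ * c) * (t + (f + (t + f))) ≡ ½ * (c * c * t + c * c * f)
  regroup = solve-∀ ℚ-ring

-- The sum Σ ± f k with the signs ω, which is meant to be as long as the list.
rad : (A → ℚ) → List A → List Bool → ℚ
rad f []       _           = 0ℚ
rad f (k ∷ ks) []          = 0ℚ
rad f (k ∷ ks) (true  ∷ ω) = rad f ks ω + f k
rad f (k ∷ ks) (false ∷ ω) = rad f ks ω - f k

-- The cross terms of independent signs average out, so `rad` turns vectors into random variables
-- with the same inner products.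
E-rad² : ∀ (ks : List A) f g → E (length ks) (λ ω → rad f ks ω * rad g ks ω) ≡ S ks (λ k → f k * g k)
E-rad² []       f g = *-zeroˡ 0ℚ
E-rad² (k ∷ ks) f g = begin
  ½ * (E d (λ ω → (X ω + f k) * (Y ω + g k)) + E d (λ ω → (X ω - f k) * (Y ω - g k)))
    ≡⟨ cong (½ *_) (sym (E-+ d (λ ω → (X ω + f k) * (Y ω + g k)) (λ ω → (X ω - f k) * (Y ω - g k)))) ⟩
  ½ * E d (λ ω → (X ω + f k) * (Y ω + g k) + (X ω - f k) * (Y ω - g k))
    ≡⟨ E-* d ½ (λ ω → (X ω + f k) * (Y ω + g k) + (X ω - f k) * (Y ω - g k)) ⟨
  E d (λ ω → ½ * ((X ω + f k) * (Y ω + g k) + (X ω - f k) * (Y ω - g k)))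
    ≡⟨ E-cong d (λ ω → average (X ω) (Y ω) (f k) (g k)) ⟩
  E d (λ ω → f k * g k + X ω * Y ω)
    ≡⟨ E-+ d (λ _ → f k * g k) (λ ω → X ω * Y ω) ⟩
  E d (λ _ → f k * g k) + E d (λ ω → X ω * Y ω)
    ≡⟨ cong₂ _+_ (E-const d (f k * g k)) (E-rad² ks f g) ⟩
  f k * g k + S ks (λ k → f k * g k) ∎
  where
  open ≡-Reasoning
  d = length ks
  X Y : List Bool → ℚ
  X = rad f ks
  Y = rad g ks
  average : ∀ x y a b → ½ * ((x + a) * (y + b) + (x - a) * (y - b)) ≡ a * b + x * y
  average = solve-∀ ℚ-ring

_² : ℚ → ℚ
q ² = q * q

-- Khinchine's inequality for the fourth moment, with the Gaussian constant 3. It controls what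
-- truncation cuts off.
E-rad⁴ : ∀ (ks : List A) f → E (length ks) (λ ω → ((rad f ks ω) ²) ²) ≤ ι 3 * (S ks (λ k → f k * f k)) ²
E-rad⁴ []       f = ≤-reflexive refl
E-rad⁴ (k ∷ ks) f = begin
  ½ * (E d (λ ω → ((X ω + a) ²) ²) + E d (λ ω → ((X ω - a) ²) ²))
    ≡⟨ cong (½ *_) (sym (E-+ d (λ ω → ((X ω + a) ²) ²) (λ ω → ((X ω - a) ²) ²))) ⟩
  ½ * E d (λ ω → ((X ω + a) ²) ² + ((X ω - a) ²) ²)
    ≡⟨ E-* d ½ (λ ω → ((X ω + a) ²) ² + ((X ω - a) ²) ²) ⟨
  E d (λ ω → ½ * (((X ω + a) ²) ² + ((X ω - a) ²) ²))
    ≡⟨ E-cong d (λ ω → average (X ω) a) ⟩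
  E d (λ ω → (a ²) ² + ι 6 * a ² * (X ω) ² + ((X ω) ²) ²)
    ≡⟨ E-+ d (λ ω → (a ²) ² + ι 6 * a ² * (X ω) ²) (λ ω → ((X ω) ²) ²) ⟩
  E d (λ ω → (a ²) ² + ι 6 * a ² * (X ω) ²) + E d (λ ω → ((X ω) ²) ²)
    ≡⟨ cong (_+ E d (λ ω → ((X ω) ²) ²)) (trans (E-+* d (λ _ → (a ²) ²) (ι 6 * a ²) (λ ω → (X ω) ²))
         (cong₂ (λ s t → s + ι 6 * a ² * t) (E-const d ((a ²) ²)) (E-rad² ks f f))) ⟩
  (a ²) ² + ι 6 * a ² * s + E d (λ ω → ((X ω) ²) ²)
    ≤⟨ +-monoʳ-≤ ((a ²) ² + ι 6 * a ² * s) (E-rad⁴ ks f) ⟩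
  (a ²) ² + ι 6 * a ² * s + ι 3 * s ²
    ≤⟨ ≤-by (ι 2 * (a ²) ²) (0≤* (0≤ι 2) (0≤² (a ²))) (complete a s) ⟩
  ι 3 * (a * a + s) ² ∎
  where
  open ≤-Reasoning
  d = length ks
  a = f k
  s = S ks (λ k → f k * f k)
  X : List Bool → ℚ
  X = rad f ks
  average : ∀ x a → ½ * (((x + a) * (x + a)) * ((x + a) * (x + a)) + ((x - a) * (x - a)) * ((x - a) * (x - a)))
    ≡ a * a * (a * a) + ι 6 * (a * a) * (x * x) + x * x * (x * x)
  average = solve-∀ ℚ-ring
  complete : ∀ a s → a * a * (a * a) + ι 6 * (a * a) * s + ι 3 * (s * s) + ι 2 * (a * a * (a * a))
    ≡ ι 3 * ((a * a + s) * (a * a + s))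
  complete = solve-∀ ℚ-ring

-- `small` keeps truncated vectors in the unit ball; `error` bounds the part cut off by a fourth
-- power, whose mean is known. The factor 64 = 4 · 4² leaves room for the multiplier 4 in `err`.
record Truncation (x : ℚ) : Set where
  field
    c     : ℚ
    lower : - ι 2 ≤ c
    upper : c ≤ ι 2
    small : c * c ≤ x * x
    error : ι 64 * ((x - c) * (x - c)) ≤ x * x * (x * x)

-- For x > 2 the error e = x - 2 satisfies 8e ≤ x², since x² - 8x + 16 = (x - 4)².
truncate : ∀ x → Truncation x
truncate x with x ≤? ι 2 | - ι 2 ≤? x
... | yes x≤2 | yes -2≤x = record
  { c = x ; lower = -2≤x ; upper = x≤2 ; small = ≤-refl
  ; error = ≤-by (x * x * (x * x)) (0≤² (x * x)) (no-error x) }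
  where
  no-error : ∀ x → ι 64 * ((x - x) * (x - x)) + x * x * (x * x) ≡ x * x * (x * x)
  no-error = solve-∀ ℚ-ring
... | no x≰2 | _ = record
  { c = ι 2 ; lower = ≤-by (ι 4) (0≤ι 4) refl ; upper = ≤-refl
  ; small = ≤-by ((x - ι 2) * (x - ι 2 + ι 4)) (0≤* 0≤e (0≤+ 0≤e (0≤ι 4))) (square x)
  ; error = ≤-by ((x - ι 4) * (x - ι 4) * (x * x + ι 8 * (x - ι 2)))
      (0≤* (0≤² (x - ι 4)) (0≤+ (0≤² x) (0≤* (0≤ι 8) 0≤e))) (fourth x) }
  where
  0≤e : 0ℚ ≤ x - ι 2
  0≤e = ≤⇒0≤- (<⇒≤ (≰⇒> x≰2))
  square : ∀ x → ι 2 * ι 2 + (x - ι 2) * (x - ι 2 + ι 4) ≡ x * x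
  square = solve-∀ ℚ-ring
  fourth : ∀ x → ι 64 * ((x - ι 2) * (x - ι 2)) + (x - ι 4) * (x - ι 4) * (x * x + ι 8 * (x - ι 2)) ≡ x * x * (x * x)
  fourth = solve-∀ ℚ-ring
... | yes _ | no -2≰x = record
  { c = - ι 2 ; lower = ≤-refl ; upper = ≤-by (ι 4) (0≤ι 4) refl
  ; small = ≤-by ((- ι 2 - x) * (- ι 2 - x + ι 4)) (0≤* 0≤e (0≤+ 0≤e (0≤ι 4))) (square x)
  ; error = ≤-by ((x + ι 4) * (x + ι 4) * (x * x + ι 8 * (- ι 2 - x)))
      (0≤* (0≤² (x + ι 4)) (0≤+ (0≤² x) (0≤* (0≤ι 8) 0≤e))) (fourth x) }
  where
  0≤e : 0ℚ ≤ - ι 2 - x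
  0≤e = ≤⇒0≤- (<⇒≤ (≰⇒> -2≰x))
  square : ∀ x → - ι 2 * - ι 2 + (- ι 2 - x) * (- ι 2 - x + ι 4) ≡ x * x
  square = solve-∀ ℚ-ring
  fourth : ∀ x → ι 64 * ((x - - ι 2) * (x - - ι 2)) + (x + ι 4) * (x + ι 4) * (x * x + ι 8 * (- ι 2 - x)) ≡ x * x * (x * x)
  fourth = solve-∀ ℚ-ring

½^_ : ℕ → ℚ
½^ zero  = 1ℚ
½^ suc k = ½ * ½^ k

¼ : ℚ
¼ = ½ * ½

0≤¼ : 0ℚ ≤ ¼
0≤¼ = 0≤* 0≤½ 0≤½

-- Grothendieck's inequality

module Rounding {K : Set} (L : List K) where
  open Dot L using () renaming (⟨_,_⟩ to ⟨_,_⟩ₗ)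

  d : ℕ
  d = length L

  signs : List (List Bool)
  signs = proj₁ (E-as-S d)

  open Dot signs

  -- Multiplying by the square root of the weight of a sign pattern makes the expectation an
  -- unweighted inner product over a list again, so that rounded vectors can be fed back into the
  -- same inequality.
  lift : (List Bool → ℚ) → List Bool → ℚ
  lift g ω = proj₁ (proj₂ (E-as-S d)) * g ω

  lift-⟨⟩ : ∀ g h → ⟨ lift g , lift h ⟩ ≡ E d (λ ω → g ω * h ω)
  lift-⟨⟩ g h = trans
    (S-cong signs (λ {ω} _ → regroup (proj₁ (proj₂ (E-as-S d))) (g ω) (h ω)))
    (trans (S-*ˡ signs (proj₁ (proj₂ (E-as-S d)) * proj₁ (proj₂ (E-as-S d))) (λ ω → g ω * h ω))
      (proj₂ (proj₂ (E-as-S d)) (λ ω → g ω * h ω)))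
    where
    regroup : ∀ c g h → c * g * (c * h) ≡ c * c * (g * h)
    regroup = solve-∀ ℚ-ring

  raw cut err : (K → ℚ) → List Bool → ℚ
  raw f = rad f L
  cut f ω = Truncation.c (truncate (raw f ω))
  err f ω = ι 4 * (raw f ω - cut f ω)

  raw≤1 : ∀ f → ⟨ f , f ⟩ₗ ≤ 1ℚ → ⟨ lift (raw f) , lift (raw f) ⟩ ≤ 1ℚ
  raw≤1 f f≤1 = subst (_≤ 1ℚ) (sym (trans (lift-⟨⟩ (raw f) (raw f)) (E-rad² L f f))) f≤1

  cut≤1 : ∀ f → ⟨ f , f ⟩ₗ ≤ 1ℚ → ⟨ lift (cut f) , lift (cut f) ⟩ ≤ 1ℚ
  cut≤1 f f≤1 = ≤-trans
    (subst₂ _≤_ (sym (lift-⟨⟩ (cut f) (cut f))) (E-rad² L f f)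
      (E-mono d (λ ω → Truncation.small (truncate (raw f ω)))))
    f≤1

  -- Four times the mean square is at most the fourth moment, hence at most 3|f|⁴ ≤ 3 < 4.
  err≤1 : ∀ f → ⟨ f , f ⟩ₗ ≤ 1ℚ → ⟨ lift (err f) , lift (err f) ⟩ ≤ 1ℚ
  err≤1 f f≤1 = *-cancelˡ-≤ (0<ι 4) (begin
    ι 4 * ⟨ lift (err f) , lift (err f) ⟩             ≡⟨ cong (ι 4 *_) (lift-⟨⟩ (err f) (err f)) ⟩
    ι 4 * E d (λ ω → err f ω * err f ω)               ≡⟨ E-* d (ι 4) (λ ω → err f ω * err f ω) ⟨
    E d (λ ω → ι 4 * (err f ω * err f ω))             ≡⟨ E-cong d (λ ω → square (raw f ω - cut f ω)) ⟩
    E d (λ ω → ι 64 * ((raw f ω - cut f ω) * (raw f ω - cut f ω)))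
                                                      ≤⟨ E-mono d (λ ω → Truncation.error (truncate (raw f ω))) ⟩
    E d (λ ω → ((raw f ω) ²) ²)                       ≤⟨ E-rad⁴ L f ⟩
    ι 3 * (w * w)                                     ≤⟨ ≤-by (ι 3 * ((1ℚ - w) * (1ℚ + w)) + 1ℚ)
                                                           (0≤+ (0≤* (0≤ι 3) (0≤* (≤⇒0≤- f≤1) (0≤+ 0≤1 0≤w))) 0≤1) (gap w) ⟩
    ι 4 * 1ℚ                                          ∎)
    where
    open ≤-Reasoning
    w : ℚ
    w = ⟨ f , f ⟩ₗ
    0≤w : 0ℚ ≤ w
    0≤w = Dot.⟨⟩-nonneg L f
    square : ∀ e → ι 4 * (ι 4 * e * (ι 4 * e)) ≡ ι 64 * (e * e)
    square = solve-∀ ℚ-ring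
    gap : ∀ w → ι 3 * (w * w) + (ι 3 * ((1ℚ - w) * (1ℚ + w)) + 1ℚ) ≡ ι 4 * 1ℚ
    gap = solve-∀ ℚ-ring

  -- xy = ce + (x - c)e + x(y - e). The first product has entries in [-2, 2] and falls under the box
  -- bound; each of the others contains an `err`, whose multiplier 4 comes out as ¼.
  split : ∀ f g → ⟨ f , g ⟩ₗ ≡
    E d (λ ω → cut f ω * cut g ω) + ¼ * ⟨ lift (err f) , lift (cut g) ⟩ + ¼ * ⟨ lift (raw f) , lift (err g) ⟩
  split f g = begin
    ⟨ f , g ⟩ₗ                                        ≡⟨ E-rad² L f g ⟨
    E d (λ ω → raw f ω * raw g ω)                     ≡⟨ E-cong d (λ ω → decompose (raw f ω) (cut f ω) (raw g ω) (cut g ω)) ⟩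
    E d (λ ω → cut f ω * cut g ω + ¼ * (err f ω * cut g ω) + ¼ * (raw f ω * err g ω))
      ≡⟨ trans (E-+* d (λ ω → cut f ω * cut g ω + ¼ * (err f ω * cut g ω)) ¼ (λ ω → raw f ω * err g ω))
           (cong (_+ ¼ * E d (λ ω → raw f ω * err g ω))
             (E-+* d (λ ω → cut f ω * cut g ω) ¼ (λ ω → err f ω * cut g ω))) ⟩
    E d (λ ω → cut f ω * cut g ω) + ¼ * E d (λ ω → err f ω * cut g ω) + ¼ * E d (λ ω → raw f ω * err g ω)
      ≡⟨ cong₂ (λ s t → E d (λ ω → cut f ω * cut g ω) + ¼ * s + ¼ * t)
           (lift-⟨⟩ (err f) (cut g)) (lift-⟨⟩ (raw f) (err g)) ⟨
    E d (λ ω → cut f ω * cut g ω) + ¼ * ⟨ lift (err f) , lift (cut g) ⟩ + ¼ * ⟨ lift (raw f) , lift (err g) ⟩ ∎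
    where
    open ≡-Reasoning
    decompose : ∀ x c y e → x * y ≡ c * e + ½ * ½ * (ι 4 * (x - c) * e) + ½ * ½ * (x * (ι 4 * (y - e)))
    decompose = solve-∀ ℚ-ring

module Form {I J : Set} (X : List I) (Y : List J) (N : I → J → ℚ) where

  ∑∑ : (I → J → ℚ) → ℚ
  ∑∑ W = S X (λ i → S Y (λ j → N i j * W i j))

  ∑∑-cong : ∀ {W W′} → (∀ i {j} → j ∈ Y → W i j ≡ W′ i j) → ∑∑ W ≡ ∑∑ W′
  ∑∑-cong eq = S-cong X (λ {i} _ → S-cong Y (λ {j} j∈Y → cong (N i j *_) (eq i j∈Y)))

  ∑∑-+* : ∀ W c W′ → ∑∑ (λ i j → W i j + c * W′ i j) ≡ ∑∑ W + c * ∑∑ W′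
  ∑∑-+* W c W′ = trans
    (S-cong X (λ {i} _ → trans (S-cong Y (λ {j} _ → distr (N i j) (W i j) c (W′ i j)))
      (S-+* Y (λ j → N i j * W i j) c (λ j → N i j * W′ i j))))
    (S-+* X (λ i → S Y (λ j → N i j * W i j)) c (λ i → S Y (λ j → N i j * W′ i j)))
    where
    distr : ∀ n w c w′ → n * (w + c * w′) ≡ n * w + c * (n * w′)
    distr = solve-∀ ℚ-ring

  ∑∑-E : ∀ d (W : I → J → List Bool → ℚ) → ∑∑ (λ i j → E d (W i j)) ≡ E d (λ ω → ∑∑ (λ i j → W i j ω))
  ∑∑-E d W = sym (trans (E-S d X (λ i ω → S Y (λ j → N i j * W i j ω)))
    (S-cong X (λ {i} _ → trans (E-S d Y (λ j ω → N i j * W i j ω))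
      (S-cong Y (λ {j} _ → E-* d (N i j) (W i j))))))

module Grothendieck {I J : Set} (X : List I) (Y : List J) (N : I → J → ℚ) (ν D : ℚ)
  (lower : ∀ i j → - ν ≤ N i j) (upper : ∀ i j → N i j ≤ ν)
  (box : ∀ (a : I → ℚ) (b : J → ℚ) → (∀ i → - ι 2 ≤ a i) → (∀ i → a i ≤ ι 2) → (∀ j → - ι 2 ≤ b j) → (∀ j → b j ≤ ι 2) →
    S X (λ i → S Y (λ j → N i j * (a i * b j))) ≤ D)
  where

  open Form X Y N

  total : ℚ
  total = ν * (ι (length X) * ι (length Y))

  module _ {K : Set} (L : List K) where
    open Dot L

    -- Cauchy-Schwarz for vectors of the unit ball, read off from 0 ≤ |x ± y|² so that no root is
    -- taken.
    trivial-bound : ∀ (x : I → K → ℚ) (y : J → K → ℚ) →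
      (∀ i → ⟨ x i , x i ⟩ ≤ 1ℚ) → (∀ j → ⟨ y j , y j ⟩ ≤ 1ℚ) →
      ∑∑ (λ i j → ⟨ x i , y j ⟩) ≤ total
    trivial-bound x y x≤1 y≤1 = ≤-trans
      (S-mono X (λ {i} _ → S-mono Y (λ {j} _ → term i j)))
      (≤-reflexive (trans (S-cong X (λ _ → S-const Y ν)) (trans (S-const X (ι (length Y) * ν))
        (rearrange (ι (length X)) (ι (length Y)) ν))))
      where
      rearrange : ∀ m n ν → m * (n * ν) ≡ ν * (m * n)
      rearrange = solve-∀ ℚ-ring
      expand : ∀ i j c → ⟨ (λ k → x i k + c * y j k) , (λ k → x i k + c * y j k) ⟩
        ≡ ⟨ x i , x i ⟩ + c * ⟨ x i , y j ⟩ + c * (⟨ x i , y j ⟩ + c * ⟨ y j , y j ⟩)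
      expand i j c = trans (⟨⟩-linʳ (λ k → x i k + c * y j k) (x i) c (y j))
        (cong₂ (λ a b → a + c * b)
          (trans (⟨⟩-linˡ (x i) c (y j) (x i)) (cong (λ t → ⟨ x i , x i ⟩ + c * t) (⟨⟩-comm (y j) (x i))))
          (⟨⟩-linˡ (x i) c (y j) (y j)))
      term : ∀ i j → N i j * ⟨ x i , y j ⟩ ≤ ν
      -- With |N| ≤ ν and |w| ≤ 1, the difference ν - Nw is half of (ν - N)(1 + w) + (ν + N)(1 - w).
      term i j = ≤-by (½ * ((ν - N i j) * (1ℚ + w) + (N i j - - ν) * (1ℚ - w)))
        (0≤* 0≤½ (0≤+ (0≤* (≤⇒0≤- (upper i j)) 0≤1+w) (0≤* (≤⇒0≤- (lower i j)) 0≤1-w)))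
        (convex ν (N i j) w)
        where
        w a b : ℚ
        w = ⟨ x i , y j ⟩
        a = ⟨ x i , x i ⟩
        b = ⟨ y j , y j ⟩
        0≤1-w : 0ℚ ≤ 1ℚ - w
        0≤1-w = subst (0ℚ ≤_) (minus a b w) (0≤* 0≤½ (0≤+ (0≤+ (≤⇒0≤- (x≤1 i)) (≤⇒0≤- (y≤1 j)))
          (subst (0ℚ ≤_) (expand i j (- 1ℚ)) (⟨⟩-nonneg (λ k → x i k + - 1ℚ * y j k)))))
          where
          minus : ∀ a b w → ½ * (1ℚ - a + (1ℚ - b) + (a + - 1ℚ * w + - 1ℚ * (w + - 1ℚ * b))) ≡ 1ℚ - w
          minus = solve-∀ ℚ-ring
        0≤1+w : 0ℚ ≤ 1ℚ + w
        0≤1+w = subst (0ℚ ≤_) (plus a b w) (0≤* 0≤½ (0≤+ (0≤+ (≤⇒0≤- (x≤1 i)) (≤⇒0≤- (y≤1 j)))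
          (subst (0ℚ ≤_) (expand i j 1ℚ) (⟨⟩-nonneg (λ k → x i k + 1ℚ * y j k)))))
          where
          plus : ∀ a b w → ½ * (1ℚ - a + (1ℚ - b) + (a + 1ℚ * w + 1ℚ * (w + 1ℚ * b))) ≡ 1ℚ + w
          plus = solve-∀ ℚ-ring
        convex : ∀ ν n w → n * w + ½ * ((ν - n) * (1ℚ + w) + (n - - ν) * (1ℚ - w)) ≡ ν
        convex = solve-∀ ℚ-ring

  -- Replacing x and y by Rademacher sums and truncating them at ±2 leaves
  -- error vectors of norm at most 1/4, so the trivial bound improves
  -- geometrically.
  grothendieck : ∀ k {K : Set} (L : List K) → let open Dot L in ∀ (x : I → K → ℚ) (y : J → K → ℚ) →
    (∀ i → ⟨ x i , x i ⟩ ≤ 1ℚ) → (∀ j → ⟨ y j , y j ⟩ ≤ 1ℚ) →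
    ∑∑ (λ i j → ⟨ x i , y j ⟩) ≤ ι 2 * D + ½^ k * (total - ι 2 * D)
  grothendieck zero L x y x≤1 y≤1 = ≤-trans (trivial-bound L x y x≤1 y≤1) (≤-reflexive (sym (cancel (ι 2 * D) total)))
    where
    cancel : ∀ d t → d + 1ℚ * (t - d) ≡ t
    cancel = solve-∀ ℚ-ring
  grothendieck (suc k) L x y x≤1 y≤1 = begin
    ∑∑ (λ i j → ⟨ x i , y j ⟩ₗ)
      ≡⟨ ∑∑-cong (λ i {j} _ → split (x i) (y j)) ⟩
    ∑∑ (λ i j → C i j + ¼ * W₁ i j + ¼ * W₂ i j)
      ≡⟨ trans (∑∑-+* (λ i j → C i j + ¼ * W₁ i j) ¼ W₂) (cong (_+ ¼ * ∑∑ W₂) (∑∑-+* C ¼ W₁)) ⟩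
    ∑∑ C + ¼ * ∑∑ W₁ + ¼ * ∑∑ W₂
      ≤⟨ +-mono-≤ (+-mono-≤ main (*-monoˡ 0≤¼ bound₁)) (*-monoˡ 0≤¼ bound₂) ⟩
    D + ¼ * G + ¼ * G
      -- The map G ↦ D + G/2 has the fixed point 2D, and one round halves the distance to it.
      ≡⟨ collect D (½^ k) total ⟩
    ι 2 * D + ½^ suc k * (total - ι 2 * D) ∎
    where
    open ≤-Reasoning
    open Dot L using () renaming (⟨_,_⟩ to ⟨_,_⟩ₗ)
    open Rounding L
    open Dot signs
    C W₁ W₂ : I → J → ℚ
    C i j = E d (λ ω → cut (x i) ω * cut (y j) ω)
    W₁ i j = ⟨ lift (err (x i)) , lift (cut (y j)) ⟩
    W₂ i j = ⟨ lift (raw (x i)) , lift (err (y j)) ⟩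
    G : ℚ
    G = ι 2 * D + ½^ k * (total - ι 2 * D)
    main : ∑∑ C ≤ D
    main = subst₂ _≤_ (sym (∑∑-E d (λ i j ω → cut (x i) ω * cut (y j) ω))) (E-const d D)
      (E-mono d (λ ω → box (λ i → cut (x i) ω) (λ j → cut (y j) ω)
        (λ i → Truncation.lower (truncate (raw (x i) ω))) (λ i → Truncation.upper (truncate (raw (x i) ω)))
        (λ j → Truncation.lower (truncate (raw (y j) ω))) (λ j → Truncation.upper (truncate (raw (y j) ω)))))
    bound₁ : ∑∑ W₁ ≤ G
    bound₁ = grothendieck k signs (λ i → lift (err (x i))) (λ j → lift (cut (y j)))
      (λ i → err≤1 (x i) (x≤1 i)) (λ j → cut≤1 (y j) (y≤1 j))
    bound₂ : ∑∑ W₂ ≤ G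
    bound₂ = grothendieck k signs (λ i → lift (raw (x i))) (λ j → lift (err (y j)))
      (λ i → raw≤1 (x i) (x≤1 i)) (λ j → err≤1 (y j) (y≤1 j))
    collect : ∀ D h t → D + ½ * ½ * (ι 2 * D + h * (t - ι 2 * D)) + ½ * ½ * (ι 2 * D + h * (t - ι 2 * D))
      ≡ ι 2 * D + ½ * h * (t - ι 2 * D)
    collect = solve-∀ ℚ-ring

-- Counting with indicators and Markov's inequality

# : List A → ℚ
# l = ι (length l)

#-filter : ∀ {P : Pred A 0ℓ} (P? : Decidable P) l → # (filter P? l) ≡ S l (λ x → 𝟙 (P? x))
#-filter P? l = begin
  # (filter P? l)               ≡⟨ *-identityʳ (# (filter P? l)) ⟨
  # (filter P? l) * 1ℚ          ≡⟨ S-const (filter P? l) 1ℚ ⟨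
  S (filter P? l) (λ _ → 1ℚ)    ≡⟨ S-filter P? l (λ _ → 1ℚ) ⟩
  S l (λ x → 𝟙 (P? x) * 1ℚ)     ≡⟨ S-cong l (λ {x} _ → *-identityʳ (𝟙 (P? x))) ⟩
  S l (λ x → 𝟙 (P? x))          ∎
  where open ≡-Reasoning

S-filter₂ : ∀ {P : Pred A 0ℓ} {R : Pred B 0ℓ} (P? : Decidable P) (R? : Decidable R) X Y (f : A → B → ℚ) →
  S (filter P? X) (λ i → S (filter R? Y) (f i)) ≡ S X (λ i → S Y (λ j → f i j * (𝟙 (P? i) * 𝟙 (R? j))))
S-filter₂ P? R? X Y f = trans (S-filter P? X (λ i → S (filter R? Y) (f i)))
  (S-cong X (λ {i} _ → trans (cong (𝟙 (P? i) *_) (S-filter R? Y (f i)))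
    (trans (sym (S-*ˡ Y (𝟙 (P? i)) (λ j → 𝟙 (R? j) * f i j)))
      (S-cong Y (λ {j} _ → regroup (𝟙 (P? i)) (𝟙 (R? j)) (f i j))))))
  where
  regroup : ∀ p r n → p * (r * n) ≡ n * (p * r)
  regroup = solve-∀ ℚ-ring

-- Used for rows and for columns: 7/8 of each keep 49/64 of the area, enough above one half for
-- `e-large`.
markov : ∀ (l : List A) f κ → (∀ x → 0ℚ ≤ f x) → 0ℚ < κ → S l f ≤ κ * # l →
  ι 7 * # l ≤ ι 8 * # (filter (λ x → f x ≤? ι 8 * κ) l)
markov l f κ 0≤f 0<κ Sf≤ = *-cancelˡ-≤ 0<κ (≤-by (κ * # l - S l f + (S l f + ι 8 * κ * g - # l * (ι 8 * κ)))
  (0≤+ (≤⇒0≤- Sf≤) (≤⇒0≤- summed)) (tidy κ (# l) (S l f) g))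
  where
  good? : Decidable (λ x → f x ≤ ι 8 * κ)
  good? x = f x ≤? ι 8 * κ
  g : ℚ
  g = # (filter good? l)
  pointwise : ∀ x → ι 8 * κ ≤ f x + ι 8 * κ * 𝟙 (good? x)
  pointwise x with good? x
  ... | yes _  = ≤-by (f x) (0≤f x) (trans (+-comm (ι 8 * κ) (f x)) (cong (f x +_) (sym (*-identityʳ (ι 8 * κ)))))
  ... | no ¬le = ≤-trans (<⇒≤ (≰⇒> ¬le)) (≤-reflexive (x+c*0 (f x) (ι 8 * κ)))
    where
    x+c*0 : ∀ a c → a ≡ a + c * 0ℚ
    x+c*0 = solve-∀ ℚ-ring
  summed : # l * (ι 8 * κ) ≤ S l f + ι 8 * κ * g
  summed = subst₂ _≤_ (S-const l (ι 8 * κ))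
    (trans (S-+* l f (ι 8 * κ) (λ x → 𝟙 (good? x))) (cong (λ t → S l f + ι 8 * κ * t) (sym (#-filter good? l))))
    (S-mono l (λ {x} _ → pointwise x))
  tidy : ∀ κ n s g → κ * (ι 7 * n) + (κ * n - s + (s + ι 8 * κ * g - n * (ι 8 * κ))) ≡ κ * (ι 8 * g)
  tidy = solve-∀ ℚ-ring

𝟙-¬ : ∀ {P : Set} (d : Dec P) → 𝟙 (¬? d) ≡ 1ℚ - 𝟙 d
𝟙-¬ (yes _) = refl
𝟙-¬ (no  _) = refl

-- From one-sided discrepancy to the norm of the form on boxes

module _ {I J : Set} (X : List I) (Y : List J) (N : I → J → ℚ) (η : ℚ)
  (whole : S X (λ i → S Y (N i)) ≤ 0ℚ)
  (parts : ∀ {P : Pred I 0ℓ} {R : Pred J 0ℓ} (P? : Decidable P) (R? : Decidable R) →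
    - η ≤ S (filter P? X) (λ i → S (filter R? Y) (N i)))
  where

  open Form X Y N

  private
    sign : ∀ {P : Set} → Dec P → ℚ
    sign d = ι 2 * 𝟙 d - 1ℚ

    -- A product of signs is 1 - 2u(1 - v) - 2(1 - u)v in the indicators u and v: the whole minus
    -- twice the two mixed blocks. Since the whole sum is not positive, lower bounds on blocks
    -- already give an upper bound, and so density decrements are the only kind of discrepancy ever
    -- sought.
    signs-bound : ∀ {P : Pred I 0ℓ} {R : Pred J 0ℓ} (P? : Decidable P) (R? : Decidable R) →
      ∑∑ (λ i j → sign (P? i) * sign (R? j)) ≤ ι 4 * η
    signs-bound P? R? = begin
      ∑∑ (λ i j → sign (P? i) * sign (R? j))
        ≡⟨ ∑∑-cong (λ i {j} _ → trans (cut (𝟙 (P? i)) (𝟙 (R? j)))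
             (sym (cong₂ (λ s t → 1ℚ + - ι 2 * (𝟙 (P? i) * s) + - ι 2 * (t * 𝟙 (R? j))) (𝟙-¬ (R? j)) (𝟙-¬ (P? i))))) ⟩
      ∑∑ (λ i j → 1ℚ + - ι 2 * (𝟙 (P? i) * 𝟙 (¬? (R? j))) + - ι 2 * (𝟙 (¬? (P? i)) * 𝟙 (R? j)))
        ≡⟨ trans (∑∑-+* (λ i j → 1ℚ + - ι 2 * (𝟙 (P? i) * 𝟙 (¬? (R? j)))) (- ι 2) (λ i j → 𝟙 (¬? (P? i)) * 𝟙 (R? j)))
             (cong (_+ - ι 2 * ∑∑ (λ i j → 𝟙 (¬? (P? i)) * 𝟙 (R? j)))
               (∑∑-+* (λ _ _ → 1ℚ) (- ι 2) (λ i j → 𝟙 (P? i) * 𝟙 (¬? (R? j))))) ⟩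
      ∑∑ (λ _ _ → 1ℚ) + - ι 2 * ∑∑ (λ i j → 𝟙 (P? i) * 𝟙 (¬? (R? j))) + - ι 2 * ∑∑ (λ i j → 𝟙 (¬? (P? i)) * 𝟙 (R? j))
        ≡⟨ cong₂ (λ s t → ∑∑ (λ _ _ → 1ℚ) + - ι 2 * s + - ι 2 * t)
             (S-filter₂ P? (λ j → ¬? (R? j)) X Y N) (S-filter₂ (λ i → ¬? (P? i)) R? X Y N) ⟨
      w + - ι 2 * s + - ι 2 * t
        ≤⟨ ≤-by (0ℚ - w + ι 2 * (s - - η + (t - - η)))
             (0≤+ (≤⇒0≤- (subst (_≤ 0ℚ) whole≡ whole))
               (0≤* (0≤ι 2) (0≤+ (≤⇒0≤- (parts P? (λ j → ¬? (R? j)))) (≤⇒0≤- (parts (λ i → ¬? (P? i)) R?)))))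
             (tidy w s t η) ⟩
      ι 4 * η ∎
      where
      open ≤-Reasoning
      w s t : ℚ
      w = ∑∑ (λ _ _ → 1ℚ)
      s = S (filter P? X) (λ i → S (filter (λ j → ¬? (R? j)) Y) (N i))
      t = S (filter (λ i → ¬? (P? i)) X) (λ i → S (filter R? Y) (N i))
      whole≡ : S X (λ i → S Y (N i)) ≡ w
      whole≡ = S-cong X (λ {i} _ → S-cong Y (λ {j} _ → sym (*-identityʳ (N i j))))
      cut : ∀ u v → (ι 2 * u - 1ℚ) * (ι 2 * v - 1ℚ) ≡ 1ℚ + - ι 2 * (u * (1ℚ - v)) + - ι 2 * ((1ℚ - u) * v)
      cut = solve-∀ ℚ-ring
      tidy : ∀ w s t η → w + - ι 2 * s + - ι 2 * t + (0ℚ - w + ι 2 * (s - - η + (t - - η))) ≡ ι 4 * η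
      tidy = solve-∀ ℚ-ring

    push : ∀ a f → - ι 2 ≤ a → a ≤ ι 2 → f * a ≤ ι 2 * (f * sign (0ℚ ≤? f))
    push a f -2≤a a≤2 with 0ℚ ≤? f
    ... | yes 0≤f = ≤-by (f * (ι 2 - a)) (0≤* 0≤f (≤⇒0≤- a≤2)) (tidy f a)
      where
      tidy : ∀ f a → f * a + f * (ι 2 - a) ≡ ι 2 * (f * (ι 2 * 1ℚ - 1ℚ))
      tidy = solve-∀ ℚ-ring
    ... | no 0≰f = ≤-by ((0ℚ - f) * (a - - ι 2)) (0≤* (≤⇒0≤- (<⇒≤ (≰⇒> 0≰f))) (≤⇒0≤- -2≤a)) (tidy f a)
      where
      tidy : ∀ f a → f * a + (0ℚ - f) * (a - - ι 2) ≡ ι 2 * (f * (ι 2 * 0ℚ - 1ℚ))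
      tidy = solve-∀ ℚ-ring

  -- A bilinear form on a box is largest at a vertex: `a` is replaced by the signs of the row sums,
  -- then `b` by the signs of the column sums. Each replacement costs the factor 2 of the interval
  -- [-2, 2], whence 16 = 2 · 2 · 4.
  box-bound : ∀ (a : I → ℚ) (b : J → ℚ) →
    (∀ i → - ι 2 ≤ a i) → (∀ i → a i ≤ ι 2) → (∀ j → - ι 2 ≤ b j) → (∀ j → b j ≤ ι 2) →
    ∑∑ (λ i j → a i * b j) ≤ ι 16 * η
  box-bound a b a≥ a≤ b≥ b≤ = begin
    ∑∑ (λ i j → a i * b j)              ≡⟨ S-cong X (λ {i} _ → pull-row i (a i)) ⟩
    S X (λ i → f i * a i)               ≤⟨ S-mono X (λ {i} _ → push (a i) (f i) (a≥ i) (a≤ i)) ⟩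
    S X (λ i → ι 2 * (f i * s i))       ≡⟨ S-*ˡ X (ι 2) (λ i → f i * s i) ⟩
    ι 2 * S X (λ i → f i * s i)         ≡⟨ cong (ι 2 *_) transpose ⟩
    ι 2 * S Y (λ j → g j * b j)         ≤⟨ *-monoˡ (0≤ι 2) (S-mono Y (λ {j} _ → push (b j) (g j) (b≥ j) (b≤ j))) ⟩
    ι 2 * S Y (λ j → ι 2 * (g j * t j)) ≡⟨ cong (ι 2 *_) (S-*ˡ Y (ι 2) (λ j → g j * t j)) ⟩
    ι 2 * (ι 2 * S Y (λ j → g j * t j)) ≡⟨ cong (λ z → ι 2 * (ι 2 * z)) untranspose ⟩
    ι 2 * (ι 2 * ∑∑ (λ i j → s i * t j)) ≤⟨ *-monoˡ (0≤ι 2) (*-monoˡ (0≤ι 2) (signs-bound (λ i → 0ℚ ≤? f i) (λ j → 0ℚ ≤? g j))) ⟩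
    ι 2 * (ι 2 * (ι 4 * η))             ≡⟨ sixteen η ⟩
    ι 16 * η                            ∎
    where
    open ≤-Reasoning
    f : I → ℚ
    f i = S Y (λ j → N i j * b j)
    s : I → ℚ
    s i = sign (0ℚ ≤? f i)
    g : J → ℚ
    g j = S X (λ i → N i j * s i)
    t : J → ℚ
    t j = sign (0ℚ ≤? g j)
    regroup : ∀ n a b → n * (a * b) ≡ n * b * a
    regroup = solve-∀ ℚ-ring
    swap : ∀ n b s → n * b * s ≡ n * s * b
    swap = solve-∀ ℚ-ring
    sixteen : ∀ η → ι 2 * (ι 2 * (ι 4 * η)) ≡ ι 16 * η
    sixteen = solve-∀ ℚ-ring
    pull-row : ∀ i c → S Y (λ j → N i j * (c * b j)) ≡ f i * c
    pull-row i c = trans (S-cong Y (λ {j} _ → regroup (N i j) c (b j))) (S-*ʳ Y c (λ j → N i j * b j))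
    transpose : S X (λ i → f i * s i) ≡ S Y (λ j → g j * b j)
    transpose = trans (S-cong X (λ {i} _ → sym (S-*ʳ Y (s i) (λ j → N i j * b j))))
      (trans (S-swap X Y (λ i j → N i j * b j * s i))
        (S-cong Y (λ {j} _ → trans (S-cong X (λ {i} _ → swap (N i j) (b j) (s i))) (S-*ʳ X (b j) (λ i → N i j * s i)))))
    untranspose : S Y (λ j → g j * t j) ≡ ∑∑ (λ i j → s i * t j)
    untranspose = trans (S-cong Y (λ {j} _ → sym (S-*ʳ X (t j) (λ i → N i j * s i))))
      (trans (S-swap Y X (λ j i → N i j * s i * t j))
        (S-cong X (λ {i} _ → S-cong Y (λ {j} _ → *-assoc (N i j) (s i) (t j)))))

0≤½^ : ∀ k → 0ℚ ≤ ½^ k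
0≤½^ zero    = 0≤1
0≤½^ (suc k) = 0≤* 0≤½ (0≤½^ k)

-- Shows that k = Q² rounds bring the Grothendieck error, which starts at Q² per cell, down to one
-- per cell.
½^k*k≤1 : ∀ k → ½^ k * ι k ≤ 1ℚ
½^k*k≤1 k = ≤-trans (*-monoˡ (0≤½^ k) (k≤2^k k)) (≤-reflexive (inverse k))
  where
  2^ : ℕ → ℚ
  2^ zero    = 1ℚ
  2^ (suc k) = ι 2 * 2^ k
  1≤2^ : ∀ k → 1ℚ ≤ 2^ k
  1≤2^ zero    = ≤-refl
  1≤2^ (suc k) = ≤-trans (1≤2^ k) (≤-by (2^ k) (≤-trans 0≤1 (1≤2^ k)) (double (2^ k)))
    where
    double : ∀ t → t + t ≡ ι 2 * t
    double = solve-∀ ℚ-ring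
  k≤2^k : ∀ k → ι k ≤ 2^ k
  k≤2^k zero    = 0≤1
  k≤2^k (suc k) = ≤-trans (+-mono-≤ (1≤2^ k) (k≤2^k k)) (≤-reflexive (double (2^ k)))
    where
    double : ∀ t → t + t ≡ ι 2 * t
    double = solve-∀ ℚ-ring
  inverse : ∀ k → ½^ k * 2^ k ≡ 1ℚ
  inverse zero    = refl
  inverse (suc k) = trans (halve (½^ k) (2^ k)) (inverse k)
    where
    halve : ∀ h t → ½ * h * (ι 2 * t) ≡ h * t
    halve = solve-∀ ℚ-ring

sqrt : ∀ n → ∃[ v ] (v ℕ.* v ℕ.≤ n × n ℕ.< suc v ℕ.* suc v)
sqrt zero = 0 , ℕ.z≤n , ℕ.s≤s ℕ.z≤n
sqrt (suc n) with sqrt n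
... | v , v²≤n , n<v⁺² with suc v ℕ.* suc v ℕₚ.≤? suc n
...   | yes v⁺²≤n⁺ = suc v , v⁺²≤n⁺ , ℕₚ.<-≤-trans (ℕ.s≤s n<v⁺²) (ℕₚ.*-mono-< (ℕₚ.n<1+n (suc v)) (ℕₚ.n<1+n (suc v)))
...   | no  v⁺²≰n⁺ = v , ℕₚ.m≤n⇒m≤1+n v²≤n , ℕₚ.≰⇒> v⁺²≰n⁺

-- One sparse rectangle: light rows, low columns, discrepancy

module Matrix {I J K : Set} (m : I → J → ℚ) (idem : ∀ i j → m i j * m i j ≡ m i j)
  (ks : List K) (V : K → J → ℚ) (span : ∀ i → Span V ks (m i))
  (r : ℚ) (0<r : 0ℚ < r) (rank≤r : # ks ≤ r)
  (Q q : ℚ) (0<q : 0ℚ < q)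
  (X : List I) (Y : List J) (0<Y : 0ℚ < # Y)
  (sparse : Q * Q * S X (λ i → S Y (m i)) ≤ q * q * (# X * # Y))
  where

  open Dot Y
  open Leverage (leverage ks V)

  ⟨⟩-scale : ∀ a b f g → ⟨ (λ x → a * f x) , (λ x → b * g x) ⟩ ≡ a * b * ⟨ f , g ⟩
  ⟨⟩-scale a b f g = trans (S-cong Y (λ {x} _ → regroup a b (f x) (g x))) (S-*ˡ Y (a * b) (λ x → f x * g x))
    where
    regroup : ∀ a b f g → a * f * (b * g) ≡ a * b * (f * g)
    regroup = solve-∀ ℚ-ring

  m-nonneg : ∀ i j → 0ℚ ≤ m i j
  m-nonneg i j = subst (0ℚ ≤_) (idem i j) (0≤² (m i j))

  Span-reproduces : ∀ {ks w} → (∀ {k} → k ∈ ks → ∀ {j} → j ∈ Y → ⟨ V k , y j ⟩ ≡ V k j) →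
    Span V ks w → ∀ {j} → j ∈ Y → ⟨ w , y j ⟩ ≡ w j
  Span-reproduces rep (nil {w} w≡0) {j} j∈Y = trans
    (trans (S-cong Y (λ {x} _ → trans (cong (_* y j x) (w≡0 x)) (*-zeroˡ (y j x)))) (S-0 Y)) (sym (w≡0 j))
  Span-reproduces rep (cons {k} {w = w} c s) {j} j∈Y = begin
    ⟨ w , y j ⟩                                                    ≡⟨ cancel ⟨ w , y j ⟩ c ⟨ V k , y j ⟩ ⟨
    ⟨ w , y j ⟩ + c * ⟨ V k , y j ⟩ - c * ⟨ V k , y j ⟩            ≡⟨ cong₂ (λ s t → s - c * t) (sym (⟨⟩-linˡ w c (V k) (y j))) (rep (here refl) j∈Y) ⟩
    ⟨ (λ x → w x + c * V k x) , y j ⟩ - c * V k j                  ≡⟨ cong (_- c * V k j) (Span-reproduces (rep ∘ there) s j∈Y) ⟩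
    w j + c * V k j - c * V k j                                    ≡⟨ cancel (w j) c (V k j) ⟩
    w j                                                            ∎
    where
    open ≡-Reasoning
    cancel : ∀ a c b → a + c * b - c * b ≡ a
    cancel = solve-∀ ℚ-ring

  row-reproduced : ∀ i {j} → j ∈ Y → ⟨ m i , y j ⟩ ≡ m i j
  row-reproduced i = Span-reproduces reproduces (span i)

  deg : I → ℚ
  deg i = ⟨ m i , m i ⟩

  deg-sum : S X (λ i → S Y (m i)) ≡ S X deg
  deg-sum = S-cong X (λ {i} _ → S-cong Y (λ {j} _ → sym (idem i j)))

  light? : Decidable (λ i → Q * Q * deg i ≤ ι 8 * (q * q * # Y))
  light? i = Q * Q * deg i ≤? ι 8 * (q * q * # Y)

  low? : Decidable (λ j → # Y * ⟨ y j , y j ⟩ ≤ ι 8 * r)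
  low? j = # Y * ⟨ y j , y j ⟩ ≤? ι 8 * r

  G : List I
  G = filter light? X

  H : List J
  H = filter low? Y

  G-large : ι 7 * # X ≤ ι 8 * # G
  G-large = markov X (λ i → Q * Q * deg i) (q * q * # Y) (λ i → 0≤* (0≤² Q) (⟨⟩-nonneg (m i)))
    (0<* (0<* 0<q 0<q) 0<Y)
    (subst₂ _≤_ (trans (cong (Q * Q *_) deg-sum) (sym (S-*ˡ X (Q * Q) deg))) (regroup q (# X) (# Y)) sparse)
    where
    regroup : ∀ q x y → q * q * (x * y) ≡ q * q * y * x
    regroup = solve-∀ ℚ-ring

  H-large : ι 7 * # Y ≤ ι 8 * # H
  H-large = markov Y (λ j → # Y * ⟨ y j , y j ⟩) r (λ j → 0≤* (<⇒≤ 0<Y) (⟨⟩-nonneg (y j))) 0<r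
    (subst₂ _≤_ (sym (S-*ˡ Y (# Y) (λ j → ⟨ y j , y j ⟩))) (*-comm (# Y) r)
      (*-monoˡ (<⇒≤ 0<Y) (≤-trans trace rank≤r)))

  -- A one at (i, j) forces 1 = ⟨m_i, y_j⟩ ≤ |m_i||y_j|, in the form 0 ≤ |9r m_i - n y_j|².
  light-low-vanish : ι 648 * (r * (q * q)) < ι 10 * (Q * Q) →
    ∀ {i} → i ∈ G → ∀ {j} → j ∈ H → m i j ≢ 1ℚ
  light-low-vanish small {i} i∈G {j} j∈H mij≡1 = (λ le → <-irrefl refl (<-≤-trans small le)) (*-cancelˡ-≤ {c = n * r} (0<* 0<Y 0<r) (≤-by
    -- The square gives 18rn ≤ 81r²d + n²w. Multiplied by Q², with Q²d ≤ 8q²n and nw ≤ 8r inserted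
    -- and rn divided out, it becomes 18Q² ≤ 648rq² + 8Q².
    (ι 81 * (r * r) * (ι 8 * (q * q * n) - Q * Q * d) + Q * Q * n * (ι 8 * r - n * w)
      + Q * Q * (ι 81 * (r * r) * d + ι 18 * (r * - n) * 1ℚ + n * n * w))
    (0≤+ (0≤+ (0≤* (0≤* (0≤ι 81) (0≤² r)) (≤⇒0≤- i-light)) (0≤* (0≤* (0≤² Q) (<⇒≤ 0<Y)) (≤⇒0≤- j-low)))
      (0≤* (0≤² Q) square))
    (tidy n r q Q d w)))
    where
    n d w : ℚ
    n = # Y
    d = deg i
    w = ⟨ y j , y j ⟩
    j∈Y : j ∈ Y
    j∈Y = proj₁ (∈-filter⁻ low? {xs = Y} j∈H)
    i-light : Q * Q * d ≤ ι 8 * (q * q * n)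
    i-light = proj₂ (∈-filter⁻ light? {xs = X} i∈G)
    j-low : n * w ≤ ι 8 * r
    j-low = proj₂ (∈-filter⁻ low? {xs = Y} j∈H)
    square : 0ℚ ≤ ι 81 * (r * r) * d + ι 18 * (r * - n) * 1ℚ + n * n * w
    square = subst (0ℚ ≤_) (begin
      ⟨ z , z ⟩
        ≡⟨ ⟨⟩-linʳ z u (- n) (y j) ⟩
      ⟨ z , u ⟩ + - n * ⟨ z , y j ⟩
        ≡⟨ cong₂ (λ s t → s + - n * t) (⟨⟩-linˡ u (- n) (y j) u) (⟨⟩-linˡ u (- n) (y j) (y j)) ⟩
      ⟨ u , u ⟩ + - n * ⟨ y j , u ⟩ + - n * (⟨ u , y j ⟩ + - n * w)
        ≡⟨ cong₂ (λ s t → s + - n * ⟨ y j , u ⟩ + - n * (t + - n * w)) (⟨⟩-scale (ι 9 * r) (ι 9 * r) (m i) (m i)) cross ⟩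
      ι 9 * r * (ι 9 * r) * d + - n * ⟨ y j , u ⟩ + - n * (ι 9 * r * 1ℚ + - n * w)
        ≡⟨ cong (λ s → ι 9 * r * (ι 9 * r) * d + - n * s + - n * (ι 9 * r * 1ℚ + - n * w)) (trans (⟨⟩-comm (y j) u) cross) ⟩
      ι 9 * r * (ι 9 * r) * d + - n * (ι 9 * r * 1ℚ) + - n * (ι 9 * r * 1ℚ + - n * w)
        ≡⟨ collect r d n w ⟩
      ι 81 * (r * r) * d + ι 18 * (r * - n) * 1ℚ + n * n * w ∎)
      (⟨⟩-nonneg z)
      where
      open ≡-Reasoning
      u z : J → ℚ
      u x = ι 9 * r * m i x
      z x = u x + - n * y j x
      cross : ⟨ u , y j ⟩ ≡ ι 9 * r * 1ℚ
      cross = trans (S-cong Y (λ {x} _ → *-assoc (ι 9 * r) (m i x) (y j x)))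
        (trans (S-*ˡ Y (ι 9 * r) (λ x → m i x * y j x)) (cong (ι 9 * r *_) (trans (row-reproduced i j∈Y) mij≡1)))
      collect : ∀ r d n w → ι 9 * r * (ι 9 * r) * d + - n * (ι 9 * r * 1ℚ) + - n * (ι 9 * r * 1ℚ + - n * w)
        ≡ ι 81 * (r * r) * d + ι 18 * (r * - n) * 1ℚ + n * n * w
      collect = solve-∀ ℚ-ring
    tidy : ∀ n r q Q d w → n * r * (ι 10 * (Q * Q))
      + (ι 81 * (r * r) * (ι 8 * (q * q * n) - Q * Q * d) + Q * Q * n * (ι 8 * r - n * w)
        + Q * Q * (ι 81 * (r * r) * d + ι 18 * (r * - n) * 1ℚ + n * n * w))
      ≡ n * r * (ι 648 * (r * (q * q)))
    tidy = solve-∀ ℚ-ring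

  -- The matrix centred at the density (q/Q)² and scaled by Q² to clear the denominator. Its sum
  -- over X × Y is at most 0 by `sparse`.
  N : I → J → ℚ
  N i j = - (q * q) + Q * Q * m i j

  SS-N : ∀ (X : List I) (Y : List J) →
    S X (λ i → S Y (N i)) ≡ # X * (# Y * - (q * q)) + Q * Q * S X (λ i → S Y (m i))
  SS-N X Y = trans
    (S-cong X (λ {i} _ → trans (S-+* Y (λ _ → - (q * q)) (Q * Q) (m i))
      (cong (_+ Q * Q * S Y (m i)) (S-const Y (- (q * q))))))
    (trans (S-+* X (λ _ → # Y * - (q * q)) (Q * Q) (λ i → S Y (m i)))
      (cong (_+ Q * Q * S X (λ i → S Y (m i))) (S-const X (# Y * - (q * q)))))

  -- v and u are √n up to a factor 2, σ is at least √r; α and β are the scales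
  -- that bring the light rows and the low columns into the unit ball.
  -- Since 5760 = 18 · 320, the bound on Q gives αβq ≥ 320.
  module Discrepancy (σ v u α β : ℚ) (0<σ : 0ℚ < σ) (0<v : 0ℚ < v) (0<u : 0ℚ < u) (0<X : 0ℚ < # X)
    (r≤σ² : r ≤ σ * σ) (v²≤n : v * v ≤ # Y) (n≤u² : # Y ≤ u * u) (u≤2v : u ≤ ι 2 * v)
    (α-eq : ι 3 * q * u * α ≡ Q) (β-eq : ι 3 * σ * β ≡ v)
    (σ≪Q : ι 5760 * σ ≤ Q) (8≤q : ι 8 ≤ q) (4q≤3Q : ι 4 * q ≤ ι 3 * Q)
    (k : ℕ) (fine : ½^ k * (Q * Q) ≤ 1ℚ)
    where

    xy e t : ℚ
    xy = # X * # Y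
    e = S G (λ i → S H (m i))
    t = α * β

    0≤q : 0ℚ ≤ q
    0≤q = <⇒≤ 0<q

    0<xy : 0ℚ < xy
    0<xy = 0<* 0<X 0<Y

    0≤ι3Q-4q : 0ℚ ≤ ι 3 * Q - ι 4 * q
    0≤ι3Q-4q = ≤⇒0≤- 4q≤3Q

    -- Density at most 9/16 leaves 7/16. This is where the density has to stay away from 1: the ones
    -- of the centred matrix carry the weight Q² - q².
    7Q²≤16[Q²-q²] : ι 7 * (Q * Q) ≤ ι 16 * (Q * Q - q * q)
    7Q²≤16[Q²-q²] = ≤-by ((ι 3 * Q - ι 4 * q) * (ι 3 * Q - ι 4 * q + ι 8 * q))
      (0≤* 0≤ι3Q-4q (0≤+ 0≤ι3Q-4q (0≤* (0≤ι 8) 0≤q))) (tidy Q q)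
      where
      tidy : ∀ Q q → ι 7 * (Q * Q) + (ι 3 * Q - ι 4 * q) * (ι 3 * Q - ι 4 * q + ι 8 * q) ≡ ι 16 * (Q * Q - q * q)
      tidy = solve-∀ ℚ-ring

    q²≤Q² : q * q ≤ Q * Q
    q²≤Q² = *-cancelˡ-≤ (0<ι 16) (≤-by (ι 16 * (Q * Q - q * q) - ι 7 * (Q * Q) + ι 7 * (Q * Q))
      (0≤+ (≤⇒0≤- 7Q²≤16[Q²-q²]) (0≤* (0≤ι 7) (0≤² Q))) (tidy Q q))
      where
      tidy : ∀ Q q → ι 16 * (q * q) + (ι 16 * (Q * Q - q * q) - ι 7 * (Q * Q) + ι 7 * (Q * Q)) ≡ ι 16 * (Q * Q)
      tidy = solve-∀ ℚ-ring

    N-lower : ∀ i j → - (Q * Q) ≤ N i j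
    N-lower i j = ≤-by (Q * Q - q * q + Q * Q * m i j) (0≤+ (≤⇒0≤- q²≤Q²) (0≤* (0≤² Q) (m-nonneg i j)))
      (tidy (Q * Q) (q * q) (m i j))
      where
      tidy : ∀ Q q m → - Q + (Q - q + Q * m) ≡ - q + Q * m
      tidy = solve-∀ ℚ-ring

    N-upper : ∀ i j → N i j ≤ Q * Q
    N-upper i j = ≤-by (q * q + Q * Q * ((1ℚ - m i j) * (1ℚ - m i j)))
      (0≤+ (0≤² q) (0≤* (0≤² Q) (0≤² (1ℚ - m i j))))
      (trans (tidy (Q * Q) (q * q) (m i j)) (trans (cong (λ z → Q * Q * (1ℚ - m i j + z)) (idem i j)) (tidy′ (Q * Q) (m i j))))
      where
      tidy : ∀ Q q m → - q + Q * m + (q + Q * ((1ℚ - m) * (1ℚ - m))) ≡ Q * (1ℚ - m + m * m)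
      tidy = solve-∀ ℚ-ring
      tidy′ : ∀ Q m → Q * (1ℚ - m + m) ≡ Q
      tidy′ = solve-∀ ℚ-ring

    -- Heavy rows, and likewise high columns in `ŷ`, become the zero vector instead of being
    -- removed: the form must stay on X × Y, where its total is known to be at most 0.
    x̂ : I → J → ℚ
    x̂ i l = 𝟙 (light? i) * α * m i l

    ŷ : J → J → ℚ
    ŷ j l = 𝟙 (low? j) * β * y j l

    masked≤1 : ∀ {P : Set} (d : Dec P) c w → (P → c * c * w ≤ 1ℚ) → 𝟙 d * c * (𝟙 d * c) * w ≤ 1ℚ
    masked≤1 (yes p) c w le = subst (_≤ 1ℚ) (one c w) (le p)
      where
      one : ∀ c w → c * c * w ≡ 1ℚ * c * (1ℚ * c) * w
      one = solve-∀ ℚ-ring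
    masked≤1 (no _) c w _ = subst (_≤ 1ℚ) (zero′ c w) 0≤1
      where
      zero′ : ∀ c w → 0ℚ ≡ 0ℚ * c * (0ℚ * c) * w
      zero′ = solve-∀ ℚ-ring

    scale-square : ∀ a c w → a * a * (c * c * w) ≡ a * c * (a * c) * w
    scale-square = solve-∀ ℚ-ring

    -- The 3 in `α-eq` is a rational bound for the √8 that Markov's factor produces; `β-eq` uses it
    -- in the same way.
    x̂≤1 : ∀ i → ⟨ x̂ i , x̂ i ⟩ ≤ 1ℚ
    x̂≤1 i = subst (_≤ 1ℚ) (sym (⟨⟩-scale (𝟙 (light? i) * α) (𝟙 (light? i) * α) (m i) (m i)))
      (masked≤1 (light? i) α (deg i) λ light → *-cancelˡ-≤ (0<* 0<3qu 0<3qu) (begin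
        a * a * (α * α * deg i)       ≡⟨ trans (scale-square a α (deg i)) (cong (λ z → z * z * deg i) α-eq) ⟩
        Q * Q * deg i                 ≤⟨ light ⟩
        ι 8 * (q * q * # Y)           ≤⟨ ≤-by (q * q * (ι 8 * (u * u - # Y) + u * u))
                                           (0≤* (0≤² q) (0≤+ (0≤* (0≤ι 8) (≤⇒0≤- n≤u²)) (0≤² u))) (tidy q (# Y) u) ⟩
        a * a * 1ℚ                    ∎))
      where
      open ≤-Reasoning
      a : ℚ
      a = ι 3 * q * u
      0<3qu : 0ℚ < a
      0<3qu = 0<* (0<* (0<ι 3) 0<q) 0<u
      tidy : ∀ q n u → ι 8 * (q * q * n) + q * q * (ι 8 * (u * u - n) + u * u) ≡ ι 3 * q * u * (ι 3 * q * u) * 1ℚ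
      tidy = solve-∀ ℚ-ring

    ŷ≤1 : ∀ j → ⟨ ŷ j , ŷ j ⟩ ≤ 1ℚ
    ŷ≤1 j = subst (_≤ 1ℚ) (sym (⟨⟩-scale (𝟙 (low? j) * β) (𝟙 (low? j) * β) (y j) (y j)))
      (masked≤1 (low? j) β w λ low → *-cancelˡ-≤ (0<* 0<3σ 0<3σ) (begin
        a * a * (β * β * w)           ≡⟨ trans (scale-square a β w) (cong (λ z → z * z * w) β-eq) ⟩
        v * v * w                     ≤⟨ ≤-by (w * (# Y - v * v)) (0≤* (⟨⟩-nonneg (y j)) (≤⇒0≤- v²≤n)) (tidy v w (# Y)) ⟩
        # Y * w                       ≤⟨ low ⟩
        ι 8 * r                       ≤⟨ ≤-by (ι 8 * (σ * σ - r) + σ * σ)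
                                           (0≤+ (0≤* (0≤ι 8) (≤⇒0≤- r≤σ²)) (0≤² σ)) (tidy′ r σ) ⟩
        a * a * 1ℚ                    ∎))
      where
      open ≤-Reasoning
      a w : ℚ
      a = ι 3 * σ
      w = ⟨ y j , y j ⟩
      0<3σ : 0ℚ < a
      0<3σ = 0<* (0<ι 3) 0<σ
      tidy : ∀ v w n → v * v * w + w * (n - v * v) ≡ n * w
      tidy = solve-∀ ℚ-ring
      tidy′ : ∀ r σ → ι 8 * r + (ι 8 * (σ * σ - r) + σ * σ) ≡ ι 3 * σ * (ι 3 * σ) * 1ℚ
      tidy′ = solve-∀ ℚ-ring

    -- The value is 320 because the lower bound for the form is (7/16) · (1/2) · tq times q|X||Y|,
    -- and 7/32 of 320 is 70. This beats the 64 = 2 · 16 · 2 lost to Grothendieck's inequality, the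
    -- box bound and the allowed discrepancy.
    320≤tq : ι 320 ≤ t * q
    320≤tq = *-cancelˡ-≤ (0<* (0<* (0<ι 18) 0<σ) 0<v) (begin
      ι 18 * σ * v * ι 320                          ≡⟨ tidy₁ σ v ⟩
      v * (ι 5760 * σ)                              ≤⟨ *-monoˡ (<⇒≤ 0<v) σ≪Q ⟩
      v * Q                                         ≡⟨ cong₂ _*_ (sym β-eq) (sym α-eq) ⟩
      ι 3 * σ * β * (ι 3 * q * u * α)               ≡⟨ tidy₂ σ β q u α ⟩
      (ι 9 * σ * (α * β * q)) * u                   ≤⟨ *-monoˡ 0≤9σtq u≤2v ⟩
      (ι 9 * σ * (α * β * q)) * (ι 2 * v)           ≡⟨ tidy₃ σ (α * β * q) v ⟩
      ι 18 * σ * v * (t * q)                        ∎)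
      where
      open ≤-Reasoning
      tidy₁ : ∀ σ v → ι 18 * σ * v * ι 320 ≡ v * (ι 5760 * σ)
      tidy₁ = solve-∀ ℚ-ring
      tidy₂ : ∀ σ β q u α → ι 3 * σ * β * (ι 3 * q * u * α) ≡ (ι 9 * σ * (α * β * q)) * u
      tidy₂ = solve-∀ ℚ-ring
      tidy₃ : ∀ σ z v → (ι 9 * σ * z) * (ι 2 * v) ≡ ι 18 * σ * v * z
      tidy₃ = solve-∀ ℚ-ring
      0≤Q : 0ℚ ≤ Q
      0≤Q = ≤-trans (0≤* (0≤ι 5760) (<⇒≤ 0<σ)) σ≪Q
      0≤9σtq : 0ℚ ≤ ι 9 * σ * (α * β * q)
      0≤9σtq = *-cancelˡ-≤ 0<u (subst₂ _≤_ (sym (*-zeroʳ u))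
        (trans (cong₂ _*_ (sym β-eq) (sym α-eq)) (trans (tidy₂ σ β q u α) (*-comm (ι 9 * σ * (α * β * q)) u)))
        (0≤* (<⇒≤ 0<v) 0≤Q))

    open Form X Y N

    -- As m² = m, the products of the centred entries with m are (Q² - q²)m: only ones contribute,
    -- and all with the same sign.
    form-value : ∑∑ (λ i j → ⟨ x̂ i , ŷ j ⟩) ≡ t * (Q * Q - q * q) * e
    form-value = begin
      ∑∑ (λ i j → ⟨ x̂ i , ŷ j ⟩)
        ≡⟨ S-cong X (λ {i} _ → S-cong Y (λ {j} j∈Y → cell i j∈Y)) ⟩
      S X (λ i → S Y (λ j → (c * m i j) * (𝟙 (light? i) * 𝟙 (low? j))))
        ≡⟨ S-filter₂ light? low? X Y (λ i j → c * m i j) ⟨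
      S G (λ i → S H (λ j → c * m i j))
        ≡⟨ trans (S-cong G (λ {i} _ → S-*ˡ H c (m i))) (S-*ˡ G c (λ i → S H (m i))) ⟩
      c * e ∎
      where
      open ≡-Reasoning
      c : ℚ
      c = t * (Q * Q - q * q)
      cell : ∀ i {j} → j ∈ Y → N i j * ⟨ x̂ i , ŷ j ⟩ ≡ (c * m i j) * (𝟙 (light? i) * 𝟙 (low? j))
      cell i {j} j∈Y = begin
        N i j * ⟨ x̂ i , ŷ j ⟩
          ≡⟨ cong (N i j *_) (trans (⟨⟩-scale (𝟙 (light? i) * α) (𝟙 (low? j) * β) (m i) (y j))
               (cong (𝟙 (light? i) * α * (𝟙 (low? j) * β) *_) (row-reproduced i j∈Y))) ⟩
        N i j * (𝟙 (light? i) * α * (𝟙 (low? j) * β) * m i j)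
          ≡⟨ tidy q Q (m i j) (𝟙 (light? i)) (𝟙 (low? j)) α β ⟩
        α * β * (𝟙 (light? i) * 𝟙 (low? j)) * (- (q * q) * m i j + Q * Q * (m i j * m i j))
          ≡⟨ cong (λ z → α * β * (𝟙 (light? i) * 𝟙 (low? j)) * (- (q * q) * m i j + Q * Q * z)) (idem i j) ⟩
        α * β * (𝟙 (light? i) * 𝟙 (low? j)) * (- (q * q) * m i j + Q * Q * m i j)
          ≡⟨ tidy′ q Q (m i j) (𝟙 (light? i)) (𝟙 (low? j)) (α * β) ⟩
        (c * m i j) * (𝟙 (light? i) * 𝟙 (low? j)) ∎
        where
        tidy : ∀ q Q m a b α β → (- (q * q) + Q * Q * m) * (a * α * (b * β) * m)
          ≡ α * β * (a * b) * (- (q * q) * m + Q * Q * (m * m))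
        tidy = solve-∀ ℚ-ring
        tidy′ : ∀ q Q m a b t → t * (a * b) * (- (q * q) * m + Q * Q * m) ≡ (t * (Q * Q - q * q) * m) * (a * b)
        tidy′ = solve-∀ ℚ-ring

    -- The absence of discrepancy is used twice. On G × H itself it leaves many ones there, so the
    -- form is at least 70q|X||Y|; through Grothendieck's inequality it keeps the form below (64q +
    -- 1)|X||Y|.
    contradiction : (∀ {P : Pred I 0ℓ} {R : Pred J 0ℓ} (P? : Decidable P) (R? : Decidable R) →
      - (ι 2 * q * xy) ≤ S (filter P? X) (λ i → S (filter R? Y) (N i))) → ⊥
    contradiction parts = <-irrefl refl (<-≤-trans 0<xy (*-cancelˡ-≤ (0<ι 47) (≤-by
        (ι 64 * q * xy + xy - Λ + (Λ - ι 70 * q * xy) + ι 6 * xy * (q - ι 8))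
        (0≤+ (0≤+ (≤⇒0≤- Λ≤) (≤⇒0≤- ≤Λ)) (0≤* (0≤* (0≤ι 6) 0≤xy) (≤⇒0≤- 8≤q))) (tidy Λ q xy))))
      where
      whole : S X (λ i → S Y (N i)) ≤ 0ℚ
      whole = subst (_≤ 0ℚ) (sym (SS-N X Y)) (≤-by (q * q * xy - Q * Q * S X (λ i → S Y (m i))) (≤⇒0≤- sparse)
        (tidy′ (# X) (# Y) q (Q * Q * S X (λ i → S Y (m i)))))
        where
        tidy′ : ∀ x y q s → x * (y * - (q * q)) + s + (q * q * (x * y) - s) ≡ 0ℚ
        tidy′ = solve-∀ ℚ-ring
      tidy : ∀ Λ q xy → ι 47 * xy + (ι 64 * q * xy + xy - Λ + (Λ - ι 70 * q * xy) + ι 6 * xy * (q - ι 8)) ≡ ι 47 * 0ℚ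
      tidy = solve-∀ ℚ-ring
      0≤xy : 0ℚ ≤ xy
      0≤xy = <⇒≤ 0<xy
      g h Λ η : ℚ
      g = # G
      h = # H
      Λ = t * (Q * Q - q * q) * e
      η = ι 2 * q * xy
      0≤t : 0ℚ ≤ t
      0≤t = *-cancelˡ-≤ 0<q (subst₂ _≤_ (sym (*-zeroʳ q)) (*-comm t q) (≤-trans (0≤ι 320) 320≤tq))
      0≤e : 0ℚ ≤ e
      0≤e = S-nonneg G (λ i → S-nonneg H (m-nonneg i))
      49xy≤64gh : ι 49 * xy ≤ ι 64 * (g * h)
      49xy≤64gh = ≤-by (ι 7 * # X * (ι 8 * h - ι 7 * # Y) + ι 8 * h * (ι 8 * g - ι 7 * # X))
        (0≤+ (0≤* (0≤* (0≤ι 7) (<⇒≤ 0<X)) (≤⇒0≤- H-large))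
          (0≤* (0≤* (0≤ι 8) (0≤ι (length H))) (≤⇒0≤- G-large)))
        (expand (# X) (# Y) g h)
        where
        expand : ∀ x y g h → ι 49 * (x * y) + (ι 7 * x * (ι 8 * h - ι 7 * y) + ι 8 * h * (ι 8 * g - ι 7 * x)) ≡ ι 64 * (g * h)
        expand = solve-∀ ℚ-ring
      -η≤ : - η ≤ g * (h * - (q * q)) + Q * Q * e
      -η≤ = subst (- η ≤_) (SS-N G H) (parts light? low?)
      -- This fixes the threshold for q: 49q²/64 - 2q ≥ q²/2 holds from q = 128/17 on, and 8 is the
      -- next integer.
      e-large : q * q * xy ≤ ι 2 * (Q * Q * e)
      e-large = *-cancelˡ-≤ (0<ι 32) (≤-by
        (ι 64 * (g * (h * - (q * q)) + Q * Q * e - - η) + q * q * (ι 64 * (g * h) - ι 49 * xy)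
          + xy * (q * (ι 17 * (q - ι 8) + ι 8)))
        (0≤+ (0≤+ (0≤* (0≤ι 64) (≤⇒0≤- -η≤)) (0≤* (0≤² q) (≤⇒0≤- 49xy≤64gh)))
          (0≤* 0≤xy (0≤* 0≤q (0≤+ (0≤* (0≤ι 17) (≤⇒0≤- 8≤q)) (0≤ι 8)))))
        (expand g h q Q e xy))
        where
        expand : ∀ g h q Q e xy → ι 32 * (q * q * xy)
          + (ι 64 * (g * (h * - (q * q)) + Q * Q * e - - (ι 2 * q * xy)) + q * q * (ι 64 * (g * h) - ι 49 * xy)
            + xy * (q * (ι 17 * (q - ι 8) + ι 8)))
          ≡ ι 32 * (ι 2 * (Q * Q * e))
        expand = solve-∀ ℚ-ring
      ≤Λ : ι 70 * q * xy ≤ Λ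
      ≤Λ = *-cancelˡ-≤ (0<ι 32) (≤-by
        (ι 2 * t * e * (ι 16 * (Q * Q - q * q) - ι 7 * (Q * Q)) + ι 7 * t * (ι 2 * (Q * Q * e) - q * q * xy)
          + ι 7 * (q * xy) * (t * q - ι 320))
        (0≤+ (0≤+ (0≤* (0≤* (0≤* (0≤ι 2) 0≤t) 0≤e) (≤⇒0≤- 7Q²≤16[Q²-q²]))
          (0≤* (0≤* (0≤ι 7) 0≤t) (≤⇒0≤- e-large)))
          (0≤* (0≤* (0≤ι 7) (0≤* 0≤q 0≤xy)) (≤⇒0≤- 320≤tq)))
        (expand t e q Q xy))
        where
        expand : ∀ t e q Q xy → ι 32 * (ι 70 * q * xy)
          + (ι 2 * t * e * (ι 16 * (Q * Q - q * q) - ι 7 * (Q * Q)) + ι 7 * t * (ι 2 * (Q * Q * e) - q * q * xy)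
            + ι 7 * (q * xy) * (t * q - ι 320))
          ≡ ι 32 * (t * (Q * Q - q * q) * e)
        expand = solve-∀ ℚ-ring
      Λ≤ : Λ ≤ ι 64 * q * xy + xy
      Λ≤ = ≤-trans (subst (_≤ ι 2 * (ι 16 * η) + ½^ k * (Q * Q * xy - ι 2 * (ι 16 * η))) form-value
          (Grothendieck.grothendieck X Y N (Q * Q) (ι 16 * η) N-lower N-upper
            (box-bound X Y N η whole parts) k Y x̂ ŷ x̂≤1 ŷ≤1))
        (≤-by (xy * (1ℚ - ½^ k * (Q * Q)) + ½^ k * (ι 64 * (q * xy)))
          (0≤+ (0≤* 0≤xy (≤⇒0≤- fine)) (0≤* (0≤½^ k) (0≤* (0≤ι 64) (0≤* 0≤q 0≤xy))))
          (expand (½^ k) q Q xy))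
        where
        expand : ∀ h q Q xy → ι 2 * (ι 16 * (ι 2 * q * xy)) + h * (Q * Q * xy - ι 2 * (ι 16 * (ι 2 * q * xy)))
          + (xy * (1ℚ - h * (Q * Q)) + h * (ι 64 * (q * xy))) ≡ ι 64 * q * xy + xy
        expand = solve-∀ ℚ-ring

-- The density-decrement induction, over natural numbers

ι-cancel-≤ : ∀ {a b} → ι a ≤ ι b → a ℕ.≤ b
ι-cancel-≤ {a} {b} ιa≤ιb with a ℕₚ.≤? b
... | yes a≤b = a≤b
... | no  a≰b = ⊥-elim (<-irrefl refl (≤-<-trans (≤-trans (ι-mono-≤ (ℕₚ.≰⇒> a≰b)) ιa≤ιb)
                  (subst (_< 1ℚ + ι b) (+-identityˡ (ι b)) (+-monoˡ-< (ι b) (0<ι 1)))))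

sumL : (A → ℕ) → List A → ℕ
sumL f l = sum (map f l)

ι-sumL : ∀ (f : A → ℕ) l → ι (sumL f l) ≡ S l (λ x → ι (f x))
ι-sumL f []      = refl
ι-sumL f (x ∷ l) = trans (ι-+ (f x) (sumL f l)) (cong (ι (f x) +_) (ι-sumL f l))

n<2^n : ∀ n → n ℕ.< 2 ℕ.^ n
n<2^n zero    = ℕ.s≤s ℕ.z≤n
n<2^n (suc n) = ℕₚ.≤-trans (ℕₚ.+-mono-≤ (ℕₚ.≤-trans (ℕ.s≤s ℕ.z≤n) (n<2^n n)) (n<2^n n))
  (ℕₚ.≤-reflexive (cong (2 ℕ.^ n ℕ.+_) (sym (ℕₚ.+-identityʳ (2 ℕ.^ n)))))

-- A sub-rectangle of size s inside one of size t whose discrepancy is at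
-- least 2qt lowers the density from (q/Q)² to (k/Q)², and q - k = ⌊t/s⌋ pays for
-- the loss of a factor t/s in size.
descend : ∀ {e Q² q s t} → e ℕ.* Q² ℕ.+ 2 ℕ.* q ℕ.* t ℕ.< q ℕ.* q ℕ.* s → s ℕ.≤ t →
  ∃[ k ] ∃[ ℓ ] (k ℕ.< q × q ≡ ℓ ℕ.+ k × e ℕ.* Q² ℕ.≤ k ℕ.* k ℕ.* s × t ℕ.≤ 2 ℕ.^ ℓ ℕ.* s)
descend {e} {Q²} {q} {zero} {t} lt _ = ⊥-elim (ℕₚ.n≮0 (ℕₚ.<-≤-trans lt (ℕₚ.≤-reflexive (ℕₚ.*-zeroʳ (q ℕ.* q)))))
descend {e} {Q²} {q} {s@(suc _)} {t} lt s≤t = q ℕ.∸ ℓ , ℓ , k<q , sym (ℕₚ.m+[n∸m]≡n ℓ≤q) , sparse , t≤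
  where
  ℓ : ℕ
  ℓ = t ℕ./ s
  ℓs≤t : ℓ ℕ.* s ℕ.≤ t
  ℓs≤t = m/n*n≤m t s
  1≤ℓ : 1 ℕ.≤ ℓ
  1≤ℓ = m≥n⇒m/n>0 s≤t
  -- The remainder of the division is below s, and ℓ + 1 ≤ 2^ℓ.
  t≤ : t ℕ.≤ 2 ℕ.^ ℓ ℕ.* s
  t≤ = ℕₚ.≤-trans (ℕₚ.≤-trans (ℕₚ.≤-reflexive (m≡m%n+[m/n]*n t s)) (ℕₚ.+-monoˡ-≤ (ℓ ℕ.* s) (ℕₚ.<⇒≤ (m%n<n t s)))) (ℕₚ.*-monoˡ-≤ s (n<2^n ℓ))
  2qℓs<q²s : 2 ℕ.* q ℕ.* (ℓ ℕ.* s) ℕ.< q ℕ.* q ℕ.* s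
  2qℓs<q²s = ℕₚ.≤-<-trans (ℕₚ.≤-trans (ℕₚ.*-monoʳ-≤ (2 ℕ.* q) ℓs≤t) (ℕₚ.m≤n+m _ (e ℕ.* Q²))) lt
  ℓ≤q : ℓ ℕ.≤ q
  ℓ≤q with ℓ ℕₚ.≤? q
  ... | yes p = p
  ... | no ¬p = ⊥-elim (ℕₚ.<-irrefl refl (ℕₚ.<-≤-trans 2qℓs<q²s
        (ℕₚ.≤-trans (ℕₚ.*-monoˡ-≤ s (ℕₚ.*-mono-≤ {q} (ℕₚ.m≤m+n q (q ℕ.+ 0)) (ℕₚ.<⇒≤ (ℕₚ.≰⇒> ¬p))))
          (ℕₚ.≤-reflexive (ℕₚ.*-assoc (2 ℕ.* q) ℓ s)))))
  k<q : q ℕ.∸ ℓ ℕ.< q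
  k<q = ℕₚ.∸-monoʳ-< 1≤ℓ ℓ≤q
  -- Since ℓs ≤ t, the discrepancy 2qt covers the 2qℓs by which q²s has to fall; the term ℓ²s of the
  -- expanded square is left over.
  sparse : e ℕ.* Q² ℕ.≤ (q ℕ.∸ ℓ) ℕ.* (q ℕ.∸ ℓ) ℕ.* s
  sparse = ℕₚ.+-cancelʳ-≤ (2 ℕ.* q ℕ.* (ℓ ℕ.* s)) _ _ (begin
    e ℕ.* Q² ℕ.+ 2 ℕ.* q ℕ.* (ℓ ℕ.* s)                 ≤⟨ ℕₚ.+-monoʳ-≤ (e ℕ.* Q²) (ℕₚ.*-monoʳ-≤ (2 ℕ.* q) ℓs≤t) ⟩
    e ℕ.* Q² ℕ.+ 2 ℕ.* q ℕ.* t                         ≤⟨ ℕₚ.<⇒≤ lt ⟩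
    q ℕ.* q ℕ.* s                                      ≤⟨ ℕₚ.m≤m+n (q ℕ.* q ℕ.* s) (ℓ ℕ.* ℓ ℕ.* s) ⟩
    q ℕ.* q ℕ.* s ℕ.+ ℓ ℕ.* ℓ ℕ.* s                    ≡⟨ cong (λ z → z ℕ.* z ℕ.* s ℕ.+ ℓ ℕ.* ℓ ℕ.* s) (ℕₚ.m+[n∸m]≡n ℓ≤q) ⟨
    (ℓ ℕ.+ k) ℕ.* (ℓ ℕ.+ k) ℕ.* s ℕ.+ ℓ ℕ.* ℓ ℕ.* s    ≡⟨ square ℓ k s ⟩
    k ℕ.* k ℕ.* s ℕ.+ 2 ℕ.* (ℓ ℕ.+ k) ℕ.* (ℓ ℕ.* s)    ≡⟨ cong (λ z → k ℕ.* k ℕ.* s ℕ.+ 2 ℕ.* z ℕ.* (ℓ ℕ.* s)) (ℕₚ.m+[n∸m]≡n ℓ≤q) ⟩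
    k ℕ.* k ℕ.* s ℕ.+ 2 ℕ.* q ℕ.* (ℓ ℕ.* s)            ∎)
    where
    open ℕₚ.≤-Reasoning
    k : ℕ
    k = q ℕ.∸ ℓ
    square : ∀ ℓ k s → (ℓ ℕ.+ k) ℕ.* (ℓ ℕ.+ k) ℕ.* s ℕ.+ ℓ ℕ.* ℓ ℕ.* s
      ≡ k ℕ.* k ℕ.* s ℕ.+ 2 ℕ.* (ℓ ℕ.+ k) ℕ.* (ℓ ℕ.* s)
    square = solve-∀-ℕ

module Edges {I J : Set} (M : I → J → Bool) where

  bit : I → J → ℕ
  bit i j = if M i j then 1 else 0

  edges : List I → List J → ℕ
  edges X Y = sumL (λ i → sumL (bit i) Y) X

module Rectangles {I J K : Set} (M : I → J → Bool)
  (ks : List K) (V : K → J → ℚ) (span : ∀ i → Span V ks (λ j → if M i j then 1ℚ else 0ℚ))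
  (r : ℕ) .{{_ : ℕ.NonZero r}} (rank≤r : length ks ℕ.≤ r)
  (σ : ℕ) .{{_ : ℕ.NonZero σ}} (r≤σ² : r ℕ.≤ σ ℕ.* σ) (Q : ℕ) (σ≪Q : 5760 ℕ.* σ ℕ.≤ Q)
  (X₀ : List I) (Y₀ : List J) (n z : ℕ) (X₀≤n : length X₀ ℕ.≤ n) (Y₀≤n : length Y₀ ℕ.≤ n)
  (zero-free : ∀ {X Y} → X ⊆ X₀ → Y ⊆ Y₀ → (∀ {i j} → i ∈ X → j ∈ Y → M i j ≡ false) →
    length X ℕ.≤ z ⊎ length Y ℕ.≤ z)
  where

  open Edges M

  m : I → J → ℚ
  m i j = if M i j then 1ℚ else 0ℚ

  idem : ∀ i j → m i j * m i j ≡ m i j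
  idem i j with M i j
  ... | true  = refl
  ... | false = refl

  ι-edges : ∀ X Y → ι (edges X Y) ≡ S X (λ i → S Y (m i))
  ι-edges X Y = trans (ι-sumL (λ i → sumL (bit i) Y) X)
    (S-cong X (λ {i} _ → trans (ι-sumL (bit i) Y) (S-cong Y (λ {j} _ → ι-bit i j))))
    where
    ι-bit : ∀ i j → ι (bit i j) ≡ m i j
    ι-bit i j with M i j
    ... | true  = refl
    ... | false = refl

  Sparse : ℕ → List I → List J → Set
  Sparse q X Y = edges X Y ℕ.* (Q ℕ.* Q) ℕ.≤ q ℕ.* q ℕ.* (length X ℕ.* length Y)

  ι-sparse : ∀ q X Y → Sparse q X Y →
    ι Q * ι Q * S X (λ i → S Y (m i)) ≤ ι q * ι q * (# X * # Y)
  ι-sparse q X Y sparse = subst₂ _≤_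
    (trans (ι-* (edges X Y) (Q ℕ.* Q)) (trans (cong₂ _*_ (ι-edges X Y) (ι-* Q Q)) (*-comm (S X (λ i → S Y (m i))) (ι Q * ι Q))))
    (trans (ι-* (q ℕ.* q) (length X ℕ.* length Y)) (cong₂ _*_ (ι-* q q) (ι-* (length X) (length Y))))
    (ι-mono-≤ sparse)

  ι-r≤σ² : ι r ≤ ι σ * ι σ
  ι-r≤σ² = subst (ι r ≤_) (ι-* σ σ) (ι-mono-≤ r≤σ²)

  ι-σ≪Q : ι 5760 * ι σ ≤ ι Q
  ι-σ≪Q = subst (_≤ ι Q) (ι-* 5760 σ) (ι-mono-≤ σ≪Q)

  -- The final rectangle accounts for 2nz: one side is at most 2z, the other at most n. Each unit of
  -- q above that may cost a factor 2.
  Bounded : ℕ → List I → List J → Set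
  Bounded q X Y = length X ℕ.* length Y ℕ.≤ 2 ℕ.^ suc q ℕ.* (n ℕ.* z)

  base : ∀ q → q ℕ.≤ 8 → ∀ X Y .{{_ : ℕ.NonZero (length Y)}} → X ⊆ X₀ → Y ⊆ Y₀ → Sparse q X Y → Bounded q X Y
  base q q≤8 X Y X⊆ Y⊆ sparse = ℕₚ.≤-trans size (ℕₚ.≤-trans (ℕₚ.≤-reflexive (twice n z)) (ℕₚ.*-monoˡ-≤ (n ℕ.* z) 2≤))
    where
    -- The density bound is relaxed to (8/Q)², which treats all q ≤ 8 at once and keeps the
    -- parameter positive when q = 0.
    open Matrix m idem ks V span (ι r) (0<ι r) (ι-mono-≤ rank≤r) (ι Q) (ι 8) (0<ι 8) X Y (0<ι (length Y))
      (ι-sparse 8 X Y (ℕₚ.≤-trans sparse (ℕₚ.*-monoˡ-≤ (length X ℕ.* length Y) (ℕₚ.*-mono-≤ q≤8 q≤8))))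
    -- Q ≥ 80σ gives Q² ≥ 80²r, and 648 · 8² < 10 · 80².
    small : ι 648 * (ι r * (ι 8 * ι 8)) < ι 10 * (ι Q * ι Q)
    small = <-≤-trans
      (subst₂ _<_ (+-identityʳ (ι 648 * (ι r * (ι 8 * ι 8)))) (gap (ι r))
        (+-monoʳ-< (ι 648 * (ι r * (ι 8 * ι 8))) (0<* (positive⁻¹ κ) (0<ι r))))
      (≤-by (ι 10 * (ι 80 * ι 80 * (ι σ * ι σ - ι r) + (ι Q - ι 80 * ι σ) * (ι Q - ι 80 * ι σ + ι 160 * ι σ)))
        (0≤* (0≤ι 10) (0≤+ (0≤* (0≤* (0≤ι 80) (0≤ι 80)) (≤⇒0≤- ι-r≤σ²))
          (0≤* 0≤Q-80σ (0≤+ 0≤Q-80σ (0≤* (0≤ι 160) (0≤ι σ))))))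
        (expand (ι r) (ι σ) (ι Q)))
      where
      κ : ℚ
      κ = ι 10 * ι 80 * ι 80 - ι 648 * (ι 8 * ι 8)
      0≤Q-80σ : 0ℚ ≤ ι Q - ι 80 * ι σ
      0≤Q-80σ = ≤⇒0≤- (subst (_≤ ι Q) (ι-* 80 σ) (ι-mono-≤ (ℕₚ.≤-trans (ℕₚ.*-monoˡ-≤ σ {80} {5760} (ℕₚ.≤ᵇ⇒≤ 80 5760 _)) σ≪Q)))
      gap : ∀ r → ι 648 * (r * (ι 8 * ι 8)) + (ι 10 * ι 80 * ι 80 - ι 648 * (ι 8 * ι 8)) * r ≡ ι 10 * ι 80 * ι 80 * r
      gap = solve-∀ ℚ-ring
      expand : ∀ r σ Q → ι 10 * ι 80 * ι 80 * r
        + ι 10 * (ι 80 * ι 80 * (σ * σ - r) + (Q - ι 80 * σ) * (Q - ι 80 * σ + ι 160 * σ)) ≡ ι 10 * (Q * Q)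
      expand = solve-∀ ℚ-ring
    zeros : ∀ {i j} → i ∈ G → j ∈ H → M i j ≡ false
    zeros {i} {j} i∈ j∈ with M i j in eq
    ... | false = refl
    ... | true  = ⊥-elim (light-low-vanish small i∈ j∈ (cong (λ b → if b then 1ℚ else 0ℚ) eq))
    half : ∀ {a b} → ι 7 * ι a ≤ ι 8 * ι b → a ℕ.≤ 2 ℕ.* b
    half {a} {b} le = ℕₚ.*-cancelˡ-≤ 7 (ℕₚ.≤-trans
      (ι-cancel-≤ {7 ℕ.* a} {8 ℕ.* b} (subst₂ _≤_ (sym (ι-* 7 a)) (sym (ι-* 8 b)) le))
      (ℕₚ.≤-trans (ℕₚ.*-monoˡ-≤ b {8} {14} (ℕₚ.≤ᵇ⇒≤ 8 14 _)) (ℕₚ.≤-reflexive (ℕₚ.*-assoc 7 2 b))))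
    size : length X ℕ.* length Y ℕ.≤ 2 ℕ.* n ℕ.* z
    size with zero-free (⊆-trans (filter-⊆ light? X) X⊆) (⊆-trans (filter-⊆ low? Y) Y⊆) zeros
    ... | inj₁ G≤z = ℕₚ.≤-trans
      (ℕₚ.*-mono-≤ (ℕₚ.≤-trans (half {length X} {length G} G-large) (ℕₚ.*-monoʳ-≤ 2 G≤z)) (ℕₚ.≤-trans (length-mono-≤ Y⊆) Y₀≤n))
      (ℕₚ.≤-reflexive (swap z n))
      where
      swap : ∀ z n → 2 ℕ.* z ℕ.* n ≡ 2 ℕ.* n ℕ.* z
      swap = solve-∀-ℕ
    ... | inj₂ H≤z = ℕₚ.≤-trans
      (ℕₚ.*-mono-≤ (ℕₚ.≤-trans (length-mono-≤ X⊆) X₀≤n) (ℕₚ.≤-trans (half {length Y} {length H} H-large) (ℕₚ.*-monoʳ-≤ 2 H≤z)))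
      (ℕₚ.≤-reflexive (swap n z))
      where
      swap : ∀ n z → n ℕ.* (2 ℕ.* z) ≡ 2 ℕ.* n ℕ.* z
      swap = solve-∀-ℕ
    twice : ∀ n z → 2 ℕ.* n ℕ.* z ≡ 2 ℕ.* (n ℕ.* z)
    twice = solve-∀-ℕ
    2≤ : 2 ℕ.≤ 2 ℕ.^ suc q
    2≤ = ℕₚ.^-monoʳ-≤ 2 {1} {suc q} (ℕ.s≤s ℕ.z≤n)

  -- Suppose the area bound fails. A sub-rectangle with discrepancy beyond 2q|X||Y| would descend to
  -- some k < q, and the bound for k times the factor 2^(q - k) would give the bound for q. So there
  -- is no such sub-rectangle, which `contradiction` excludes.
  step : ∀ q → 8 ℕ.≤ q → 4 ℕ.* q ℕ.≤ 3 ℕ.* Q →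
    (∀ {k} → k ℕ.< q → ∀ X Y → X ⊆ X₀ → Y ⊆ Y₀ → Sparse k X Y → Bounded k X Y) →
    ∀ X Y .{{_ : ℕ.NonZero (length X)}} .{{_ : ℕ.NonZero (length Y)}} → X ⊆ X₀ → Y ⊆ Y₀ → Sparse q X Y → Bounded q X Y
  step q 8≤q 4q≤3Q rec X Y X⊆ Y⊆ sparse with length X ℕ.* length Y ℕₚ.≤? 2 ℕ.^ suc q ℕ.* (n ℕ.* z)
  ... | yes bounded = bounded
  ... | no unbounded with sqrt (length Y)
  ...   | v , v²≤n , n<v⁺² = ⊥-elim (Discrepancy.contradiction
    (ι σ) (ι v) (ι (suc v)) (ι Q * proj₁ α⁻¹) (ι v * proj₁ β⁻¹) (0<ι σ) 0<ιv (0<ι (suc v)) (0<ι (length X))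
    ι-r≤σ² (subst (_≤ # Y) (ι-* v v) (ι-mono-≤ v²≤n))
    (subst (# Y ≤_) (ι-* (suc v) (suc v)) (ι-mono-≤ (ℕₚ.<⇒≤ n<v⁺²)))
    (subst (ι (suc v) ≤_) (ι-* 2 v) (ι-mono-≤ v⁺≤2v))
    (scaled (ι 3 * ι q * ι (suc v)) (ι Q) α⁻¹) (scaled (ι 3 * ι σ) (ι v) β⁻¹) ι-σ≪Q (ι-mono-≤ 8≤q)
    (subst₂ _≤_ (ι-* 4 q) (ι-* 3 Q) (ι-mono-≤ 4q≤3Q))
    -- The number of Grothendieck rounds.
    (Q ℕ.* Q) (subst (λ s → ½^ (Q ℕ.* Q) * s ≤ 1ℚ) (ι-* Q Q) (½^k*k≤1 (Q ℕ.* Q)))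
    (λ P? R? → part (filter-⊆ P? X) (filter-⊆ R? Y)))
    where
    0<q : 0ℚ < ι q
    0<q = <-≤-trans (0<ι 8) (ι-mono-≤ 8≤q)
    open Matrix m idem ks V span (ι r) (0<ι r) (ι-mono-≤ rank≤r) (ι Q) (ι q) 0<q X Y (0<ι (length Y))
      (ι-sparse q X Y sparse)
    pos : ∀ v → length Y ℕ.< suc v ℕ.* suc v → 1 ℕ.≤ v
    pos (suc _) _  = ℕ.s≤s ℕ.z≤n
    pos zero    lt = ⊥-elim (ℕₚ.<-irrefl refl (ℕₚ.<-≤-trans lt (ℕ.>-nonZero⁻¹ (length Y))))
    1≤v : 1 ℕ.≤ v
    1≤v = pos v n<v⁺²
    0<ιv : 0ℚ < ι v
    0<ιv = <-≤-trans (0<ι 1) (ι-mono-≤ 1≤v)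
    v⁺≤2v : suc v ℕ.≤ 2 ℕ.* v
    v⁺≤2v = ℕₚ.≤-trans (ℕₚ.+-monoˡ-≤ v 1≤v) (ℕₚ.≤-reflexive (cong (v ℕ.+_) (sym (ℕₚ.+-identityʳ v))))
    α⁻¹ : ∃[ w ] ι 3 * ι q * ι (suc v) * w ≡ 1ℚ
    α⁻¹ = recip (ι 3 * ι q * ι (suc v)) (≢-sym (<⇒≢ (0<* (0<* (0<ι 3) 0<q) (0<ι (suc v)))))
    β⁻¹ : ∃[ w ] ι 3 * ι σ * w ≡ 1ℚ
    β⁻¹ = recip (ι 3 * ι σ) (≢-sym (<⇒≢ (0<* (0<ι 3) (0<ι σ))))
    scaled : ∀ a b (a⁻¹ : ∃[ w ] a * w ≡ 1ℚ) → a * (b * proj₁ a⁻¹) ≡ b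
    scaled a b (w , aw≡1) = trans (regroup a b w) (trans (cong (b *_) aw≡1) (*-identityʳ b))
      where
      regroup : ∀ a b w → a * (b * w) ≡ b * (a * w)
      regroup = solve-∀ ℚ-ring
    t : ℕ
    t = length X ℕ.* length Y
    part : ∀ {X′ Y′} → X′ ⊆ X → Y′ ⊆ Y → - (ι 2 * ι q * (# X * # Y)) ≤ S X′ (λ i → S Y′ (N i))
    part {X′} {Y′} X′⊆ Y′⊆ with q ℕ.* q ℕ.* (length X′ ℕ.* length Y′) ℕₚ.≤? edges X′ Y′ ℕ.* (Q ℕ.* Q) ℕ.+ 2 ℕ.* q ℕ.* t
    ... | no dense with descend {edges X′ Y′} (ℕₚ.≰⇒> dense) (ℕₚ.*-mono-≤ (length-mono-≤ X′⊆) (length-mono-≤ Y′⊆))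
    ...   | k , ℓ , k<q , q≡ℓ+k , sparse′ , t≤ = ⊥-elim (unbounded (begin
        t                                             ≤⟨ t≤ ⟩
        2 ℕ.^ ℓ ℕ.* (length X′ ℕ.* length Y′)         ≤⟨ ℕₚ.*-monoʳ-≤ (2 ℕ.^ ℓ) (rec k<q X′ Y′ (⊆-trans X′⊆ X⊆) (⊆-trans Y′⊆ Y⊆) sparse′) ⟩
        2 ℕ.^ ℓ ℕ.* (2 ℕ.^ suc k ℕ.* (n ℕ.* z))       ≡⟨ ℕₚ.*-assoc (2 ℕ.^ ℓ) (2 ℕ.^ suc k) (n ℕ.* z) ⟨
        2 ℕ.^ ℓ ℕ.* 2 ℕ.^ suc k ℕ.* (n ℕ.* z)         ≡⟨ cong (ℕ._* (n ℕ.* z)) (ℕₚ.^-distribˡ-+-* 2 ℓ (suc k)) ⟨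
        2 ℕ.^ (ℓ ℕ.+ suc k) ℕ.* (n ℕ.* z)             ≡⟨ cong (λ e → 2 ℕ.^ e ℕ.* (n ℕ.* z)) (trans (ℕₚ.+-suc ℓ k) (cong suc (sym q≡ℓ+k))) ⟩
        2 ℕ.^ suc q ℕ.* (n ℕ.* z)                     ∎))
      where open ℕₚ.≤-Reasoning
    part {X′} {Y′} _ _ | yes sparse′ = subst (- (ι 2 * ι q * (# X * # Y)) ≤_) (sym (SS-N X′ Y′))
      (≤-by (ι (edges X′ Y′ ℕ.* (Q ℕ.* Q) ℕ.+ 2 ℕ.* q ℕ.* t) - ι (q ℕ.* q ℕ.* s′)) (≤⇒0≤- (ι-mono-≤ sparse′))
        (trans (cong₂ (λ a b → - (ι 2 * ι q * (# X * # Y)) + (a - b)) lhs rhs)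
          (tidy (ι q) (ι Q) (# X * # Y) (# X′) (# Y′) (S X′ (λ i → S Y′ (m i))))))
      where
      s′ : ℕ
      s′ = length X′ ℕ.* length Y′
      lhs : ι (edges X′ Y′ ℕ.* (Q ℕ.* Q) ℕ.+ 2 ℕ.* q ℕ.* t) ≡ S X′ (λ i → S Y′ (m i)) * (ι Q * ι Q) + ι 2 * ι q * (# X * # Y)
      lhs = trans (ι-+ (edges X′ Y′ ℕ.* (Q ℕ.* Q)) (2 ℕ.* q ℕ.* t)) (cong₂ _+_
        (trans (ι-* (edges X′ Y′) (Q ℕ.* Q)) (cong₂ _*_ (ι-edges X′ Y′) (ι-* Q Q)))
        (trans (ι-* (2 ℕ.* q) t) (cong₂ _*_ (ι-* 2 q) (ι-* (length X) (length Y)))))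
      rhs : ι (q ℕ.* q ℕ.* s′) ≡ ι q * ι q * (# X′ * # Y′)
      rhs = trans (ι-* (q ℕ.* q) s′) (cong₂ _*_ (ι-* q q) (ι-* (length X′) (length Y′)))
      tidy : ∀ q Q xy x′ y′ e → - (ι 2 * q * xy) + (e * (Q * Q) + ι 2 * q * xy - q * q * (x′ * y′))
        ≡ x′ * (y′ * - (q * q)) + Q * Q * e
      tidy = solve-∀ ℚ-ring

  bounded : ∀ q → 4 ℕ.* q ℕ.≤ 3 ℕ.* Q → ∀ X Y → X ⊆ X₀ → Y ⊆ Y₀ → Sparse q X Y → Bounded q X Y
  bounded = <-rec (λ q → 4 ℕ.* q ℕ.≤ 3 ℕ.* Q → ∀ X Y → X ⊆ X₀ → Y ⊆ Y₀ → Sparse q X Y → Bounded q X Y) go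
    where
    go : ∀ q → (∀ {k} → k ℕ.< q → 4 ℕ.* k ℕ.≤ 3 ℕ.* Q → ∀ X Y → X ⊆ X₀ → Y ⊆ Y₀ → Sparse k X Y → Bounded k X Y) →
      4 ℕ.* q ℕ.≤ 3 ℕ.* Q → ∀ X Y → X ⊆ X₀ → Y ⊆ Y₀ → Sparse q X Y → Bounded q X Y
    go q rec 4q≤3Q [] Y X⊆ Y⊆ sparse = ℕ.z≤n
    go q rec 4q≤3Q (i ∷ X) [] X⊆ Y⊆ sparse = ℕₚ.≤-trans (ℕₚ.≤-reflexive (ℕₚ.*-zeroʳ (length X))) ℕ.z≤n
    go q rec 4q≤3Q X@(_ ∷ _) Y@(_ ∷ _) X⊆ Y⊆ sparse with q ℕₚ.≤? 8
    ... | yes q≤8 = base q q≤8 X Y X⊆ Y⊆ sparse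
    ... | no  q≰8 = step q (ℕₚ.<⇒≤ (ℕₚ.≰⇒> q≰8)) 4q≤3Q
      (λ k<q → rec k<q (ℕₚ.≤-trans (ℕₚ.*-monoʳ-≤ 4 (ℕₚ.<⇒≤ k<q)) 4q≤3Q)) X Y X⊆ Y⊆ sparse

-- From subsets to lists, and rows spanned by a maximal independent set

S-tabulate : ∀ {A : Set} {n} (g : Fin n → A) f → S (tabulate g) f ≡ sumℚ (f ∘ g)
S-tabulate {n = zero}  g f = refl
S-tabulate {n = suc n} g f = cong (f (g zero) +_) (S-tabulate (g ∘ suc) f)

sumL-tabulate : ∀ {A : Set} {n} (g : Fin n → A) f → sumL f (tabulate g) ≡ sumℕ (f ∘ g)
sumL-tabulate {n = zero}  g f = refl
sumL-tabulate {n = suc n} g f = cong (f (g zero) ℕ.+_) (sumL-tabulate (g ∘ suc) f)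

elements : ∀ {n} → Subset n → List (Fin n)
elements []            = []
elements (inside  ∷ p) = zero ∷ map suc (elements p)
elements (outside ∷ p) = map suc (elements p)

length-elements : ∀ {n} (p : Subset n) → length (elements p) ≡ ∣ p ∣
length-elements []            = refl
length-elements (inside  ∷ p) = cong suc (trans (length-map suc (elements p)) (length-elements p))
length-elements (outside ∷ p) = trans (length-map suc (elements p)) (length-elements p)

∈-elements : ∀ {n} {p : Subset n} {i} → i Subset.∈ p → i ∈ elements p
∈-elements {p = inside  ∷ p} here       = here refl
∈-elements {p = inside  ∷ p} (there i∈) = there (∈-map⁺ suc (∈-elements i∈))
∈-elements {p = outside ∷ p} (there i∈) = ∈-map⁺ suc (∈-elements i∈)

-- The tabulated function is arbitrary because the recursion composes it with `suc`.
sublist-subset : ∀ {A : Set} {n} (f : Fin n → A) {xs} → xs ⊆ tabulate f →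
  Σ[ p ∈ Subset n ] (∣ p ∣ ≡ length xs × (∀ {i} → i Subset.∈ p → f i ∈ xs))
sublist-subset {n = zero}  f []       = [] , refl , λ ()
sublist-subset {n = suc n} f (_ ∷ʳ τ) with sublist-subset (f ∘ suc) τ
... | p , len , mem = outside ∷ p , len , λ { (there i∈) → mem i∈ }
sublist-subset {n = suc n} f (refl ∷ τ) with sublist-subset (f ∘ suc) τ
... | p , len , mem = inside ∷ p , cong suc len , λ { here → here refl ; (there i∈) → there (mem i∈) }

module _ {n} (M : BinMatrix n) (k : ℕ) (isRank : IsRank M k) where

  private
    p₀ : Subset n
    p₀ = proj₁ (proj₁ isRank)
    open Dot (allFin n)

  -- Otherwise some φ kills the rows of p₀ but not row i. Applied to a vanishing combination of the
  -- rows in p₀ ∪ ⁅ i ⁆, it leaves only the term of i, so `a i` = 0 and the independence of p₀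
  -- finishes: a larger independent set, against maximality.
  rows-spanned : ∀ i → Span (entry M) (elements p₀) (entry M i)
  rows-spanned i with Fredholm.span-or-separated (allFin n) (∈-allFin {n}) (entry M) (elements p₀) (entry M i)
  ... | inj₁ s = s
  ... | inj₂ (φ , φ⟂ , φmᵢ≢0) = ⊥-elim (ℕₚ.<-irrefl refl (ℕₚ.<-≤-trans
      (subst (ℕ._< ∣ p₀ ∪ ⁅ i ⁆ ∣) (proj₁ (proj₂ (proj₁ isRank)))
        (Subsetₚ.p⊂q⇒∣p∣<∣q∣ (Subsetₚ.p⊆p∪q ⁅ i ⁆ , i , i∈p∪ , i∉p₀)))
      (proj₂ isRank ∣ p₀ ∪ ⁅ i ⁆ ∣ (p₀ ∪ ⁅ i ⁆ , refl , independent))))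
    where
    i∈p∪ : i Subset.∈ p₀ ∪ ⁅ i ⁆
    i∈p∪ = Subsetₚ.x∈p∪q⁺ (inj₂ (Subsetₚ.x∈⁅x⁆ i))
    i∉p₀ : i Subset.∉ p₀
    i∉p₀ i∈p₀ = φmᵢ≢0 (φ⟂ (∈-elements i∈p₀))
    independent : RowsIndependent M (p₀ ∪ ⁅ i ⁆)
    independent a supp rel = proj₂ (proj₂ (proj₁ isRank)) a supp₀ rel
      where
      open ≡-Reasoning
      T : Fin n → ℚ
      T l = a l * ⟨ φ , entry M l ⟩
      T-sum : S (allFin n) T ≡ 0ℚ
      T-sum = begin
        S (allFin n) (λ l → a l * ⟨ φ , entry M l ⟩)
          ≡⟨ S-cong (allFin n) (λ {l} _ → sym (S-*ˡ (allFin n) (a l) (λ j → φ j * entry M l j))) ⟩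
        S (allFin n) (λ l → S (allFin n) (λ j → a l * (φ j * entry M l j)))
          ≡⟨ S-swap (allFin n) (allFin n) (λ l j → a l * (φ j * entry M l j)) ⟩
        S (allFin n) (λ j → S (allFin n) (λ l → a l * (φ j * entry M l j)))
          ≡⟨ S-cong (allFin n) (λ {j} _ → column j) ⟩
        S (allFin n) (λ _ → 0ℚ)
          ≡⟨ S-0 (allFin n) ⟩
        0ℚ ∎
        where
        regroup : ∀ a f m → a * (f * m) ≡ f * (a * m)
        regroup = solve-∀ ℚ-ring
        column : ∀ j → S (allFin n) (λ l → a l * (φ j * entry M l j)) ≡ 0ℚ
        column j = begin
          S (allFin n) (λ l → a l * (φ j * entry M l j))   ≡⟨ S-cong (allFin n) (λ {l} _ → regroup (a l) (φ j) (entry M l j)) ⟩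
          S (allFin n) (λ l → φ j * (a l * entry M l j))   ≡⟨ S-*ˡ (allFin n) (φ j) (λ l → a l * entry M l j) ⟩
          φ j * S (allFin n) (λ l → a l * entry M l j)     ≡⟨ cong (φ j *_) (trans (S-tabulate (λ l → l) (λ l → a l * entry M l j)) (rel j)) ⟩
          φ j * 0ℚ                                         ≡⟨ *-zeroʳ (φ j) ⟩
          0ℚ                                               ∎
      T-other : ∀ {l} → l ≢ i → T l ≡ 0ℚ
      T-other {l} l≢i with l Subsetₚ.∈? p₀
      ... | yes l∈ = trans (cong (a l *_) (φ⟂ (∈-elements l∈))) (*-zeroʳ (a l))
      ... | no  l∉ = trans (cong (_* ⟨ φ , entry M l ⟩) (supp l l∉p∪)) (*-zeroˡ ⟨ φ , entry M l ⟩)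
        where
        l∉p∪ : l Subset.∉ p₀ ∪ ⁅ i ⁆
        l∉p∪ l∈p∪ with Subsetₚ.x∈p∪q⁻ p₀ ⁅ i ⁆ l∈p∪
        ... | inj₁ l∈p₀ = l∉ l∈p₀
        ... | inj₂ l∈⁅i⁆ = l≢i (Subsetₚ.x∈⁅y⁆⇒x≡y i l∈⁅i⁆)
      -- T i is the only nonzero term, so every T l · T i is nonnegative.
      T-i : T i * T i ≡ 0ℚ
      T-i = S-zero (allFin n) {λ l → T l * T i} nonneg
        (trans (S-*ʳ (allFin n) (T i) T) (trans (cong (_* T i) T-sum) (*-zeroˡ (T i)))) (∈-allFin i)
        where
        nonneg : ∀ l → 0ℚ ≤ T l * T i
        nonneg l with l Finₚ.≟ i
        ... | yes refl = 0≤² (T l)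
        ... | no  l≢i  = ≤-reflexive (sym (trans (cong (_* T i) (T-other l≢i)) (*-zeroˡ (T i))))
      aᵢ≡0 : a i ≡ 0ℚ
      aᵢ≡0 with T i ≟ 0ℚ
      ... | yes Tᵢ≡0 = *-zero-divisor (trans (*-comm ⟨ φ , entry M i ⟩ (a i)) Tᵢ≡0) φmᵢ≢0
      ... | no  Tᵢ≢0 = ⊥-elim (Tᵢ≢0 (*-zero-divisor T-i Tᵢ≢0))
      supp₀ : ∀ l → l Subset.∉ p₀ → a l ≡ 0ℚ
      supp₀ l l∉ with l Finₚ.≟ i
      ... | yes refl = aᵢ≡0
      ... | no  l≢i  = supp l λ l∈ → case-∪ (Subsetₚ.x∈p∪q⁻ p₀ ⁅ i ⁆ l∈)
        where
        case-∪ : l Subset.∈ p₀ ⊎ l Subset.∈ ⁅ i ⁆ → ⊥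
        case-∪ (inj₁ l∈p₀)  = l∉ l∈p₀
        case-∪ (inj₂ l∈⁅i⁆) = l≢i (Subsetₚ.x∈⁅y⁆⇒x≡y i l∈⁅i⁆)

-- Existence of z and its bound on all-zero rectangles

greatest : ∀ {P : ℕ → Set} → (∀ k → Dec (P k)) → ∀ b → (∀ k → P k → k ℕ.≤ b) → P 0 → ∃[ k ] IsGreatest P k
greatest P? zero    P≤b P0 = 0 , P0 , P≤b
greatest P? (suc b) P≤b P0 with P? (suc b)
... | yes Pb = suc b , Pb , P≤b
... | no ¬Pb = greatest P? b (λ k Pk → ℕₚ.≤-pred (ℕₚ.≤∧≢⇒< (P≤b k Pk) (λ { refl → ¬Pb Pk }))) P0

module _ {n} (M : BinMatrix n) where

  ZeroSquare : ℕ → Set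
  ZeroSquare k = Σ[ X ∈ Subset n ] Σ[ Y ∈ Subset n ]
    (∣ X ∣ ≡ k × ∣ Y ∣ ≡ k × (∀ i j → i Subset.∈ X → j Subset.∈ Y → M i j ≡ false))

  zeroSquare? : ∀ k → Dec (ZeroSquare k)
  zeroSquare? k = Subsetₚ.anySubset? λ X → Subsetₚ.anySubset? λ Y →
    (∣ X ∣ ℕₚ.≟ k) ×-dec (∣ Y ∣ ℕₚ.≟ k) ×-dec
    Finₚ.all? λ i → Finₚ.all? λ j → (i Subsetₚ.∈? X) →-dec (j Subsetₚ.∈? Y) →-dec (M i j 𝔹ₚ.≟ false)

  z-exists : ∃[ z ] IsZ M z
  z-exists = greatest zeroSquare? n (λ { k (X , _ , refl , _) → Subsetₚ.∣p∣≤n X })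
    (Subset.⊥ , Subset.⊥ , Subsetₚ.∣⊥∣≡0 n , Subsetₚ.∣⊥∣≡0 n , λ i j i∈ _ → ⊥-elim (Subsetₚ.∉⊥ i∈))

  -- If both sides exceeded z, their first z + 1 rows and columns would form a larger zero square.
  zero-rectangle : ∀ {z} → IsZ M z → ∀ {X Y} → X ⊆ allFin n → Y ⊆ allFin n →
    (∀ {i j} → i ∈ X → j ∈ Y → M i j ≡ false) → length X ℕ.≤ z ⊎ length Y ℕ.≤ z
  zero-rectangle {z} isZ {X} {Y} X⊆ Y⊆ zeros with length X ℕₚ.≤? z | length Y ℕₚ.≤? z
  ... | yes X≤z | _ = inj₁ X≤z
  ... | no  _   | yes Y≤z = inj₂ Y≤z
  ... | no  X≰z | no Y≰z with sublist-subset (λ i → i) (⊆-trans (take-⊆ (suc z) X) X⊆)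
                            | sublist-subset (λ i → i) (⊆-trans (take-⊆ (suc z) Y) Y⊆)
  ...   | p , ∣p∣ , p∈ | q , ∣q∣ , q∈ = ⊥-elim (ℕₚ.1+n≰n (proj₂ isZ (suc z)
    (p , q , trans ∣p∣ (size X X≰z) , trans ∣q∣ (size Y Y≰z) ,
      λ i j i∈ j∈ → zeros (lookup (take-⊆ (suc z) X) (p∈ i∈)) (lookup (take-⊆ (suc z) Y) (q∈ j∈)))))
    where
    size : ∀ (W : List (Fin n)) → ¬ length W ℕ.≤ z → length (take (suc z) W) ≡ suc z
    size W W≰z = trans (length-take (suc z) W) (ℕₚ.m≤n⇒m⊓n≡m (ℕₚ.≰⇒> W≰z))

-- Fractions, the exponent c√r and the choice of constants

fraction : ∀ a b .{{_ : ℕ.NonZero b}} → (ℤ.+ a ℚ./ b) * (ℤ.+ b ℚ./ 1) ≡ ℤ.+ a ℚ./ 1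
fraction a (suc b) = toℚᵘ-injective (ℚᵘₚ.≃-trans (toℚᵘ-homo-* (ℤ.+ a ℚ./ suc b) (ℤ.+ suc b ℚ./ 1))
  (ℚᵘₚ.≃-trans (ℚᵘₚ.*-cong (toℚᵘ-fromℚᵘ (ℚᵘ.mkℚᵘ (ℤ.+ a) b)) (toℚᵘ-fromℚᵘ (ℚᵘ.mkℚᵘ (ℤ.+ suc b) 0)))
    (ℚᵘₚ.≃-trans (ℚᵘ.*≡* (cross (ℤ.+ a) (ℤ.+ suc b) )) (ℚᵘₚ.≃-sym (toℚᵘ-fromℚᵘ (ℚᵘ.mkℚᵘ (ℤ.+ a) 0))))))
  where
  cross : ∀ a b → a ℤ.* b ℤ.* ℤ.+ 1 ≡ a ℤ.* (b ℤ.* ℤ.+ 1)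
  cross = solve-∀-ℤ

ι≡/1 : ∀ n → ι n ≡ ℤ.+ n ℚ./ 1
ι≡/1 zero    = refl
ι≡/1 (suc n) = trans (cong (1ℚ +_) (ι≡/1 n)) (toℚᵘ-injective (ℚᵘₚ.≃-trans (toℚᵘ-homo-+ 1ℚ (ℤ.+ n ℚ./ 1))
  (ℚᵘₚ.≃-trans (ℚᵘₚ.+-cong (ℚᵘₚ.≃-refl {ℚᵘ.1ℚᵘ}) (toℚᵘ-fromℚᵘ (ℚᵘ.mkℚᵘ (ℤ.+ n) 0)))
    (ℚᵘₚ.≃-trans (ℚᵘ.*≡* (cross (ℤ.+ n))) (ℚᵘₚ.≃-sym (toℚᵘ-fromℚᵘ (ℚᵘ.mkℚᵘ (ℤ.+ suc n) 0)))))))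
  where
  cross : ∀ n → (ℤ.+ 1 ℤ.* ℤ.+ 1 ℤ.+ n ℤ.* ℤ.+ 1) ℤ.* ℤ.+ 1 ≡ (ℤ.+ 1 ℤ.+ n) ℤ.* (ℤ.+ 1 ℤ.* ℤ.+ 1)
  cross = solve-∀-ℤ

/-ι : ∀ a b .{{_ : ℕ.NonZero b}} → (ℤ.+ a ℚ./ b) * ι b ≡ ι a
/-ι a b = trans (cong ((ℤ.+ a ℚ./ b) *_) (ι≡/1 b)) (trans (fraction a b) (sym (ι≡/1 a)))

^-distribʳ-* : ∀ b x y → (x ℕ.* y) ℕ.^ b ≡ x ℕ.^ b ℕ.* y ℕ.^ b
^-distribʳ-* zero    x y = refl
^-distribʳ-* (suc b) x y = trans (cong (x ℕ.* y ℕ.*_) (^-distribʳ-* b x y)) (interchange x y (x ℕ.^ b) (y ℕ.^ b))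
  where
  interchange : ∀ x y u v → x ℕ.* y ℕ.* (u ℕ.* v) ≡ x ℕ.* u ℕ.* (y ℕ.* v)
  interchange = solve-∀-ℕ

²-cancel-≤ : ∀ {a b} → a ℕ.* a ℕ.≤ b ℕ.* b → a ℕ.≤ b
²-cancel-≤ {a} {b} le with a ℕₚ.≤? b
... | yes a≤b = a≤b
... | no  a≰b = ⊥-elim (ℕₚ.<-irrefl refl (ℕₚ.<-≤-trans (ℕₚ.*-mono-< (ℕₚ.≰⇒> a≰b) (ℕₚ.≰⇒> a≰b)) le))

-- κσ ≤ 2κ√r ≤ a/b, compared through squares with b² cleared.
exponent-bound : ∀ κ {r σ} a b .{{_ : ℕ.NonZero b}} → σ ℕ.* σ ℕ.≤ 4 ℕ.* r →
  (ℤ.+ (2 ℕ.* κ) ℚ./ 1) * (ℤ.+ (2 ℕ.* κ) ℚ./ 1) * (ℤ.+ r ℚ./ 1) ≤ (ℤ.+ a ℚ./ b) * (ℤ.+ a ℚ./ b) →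
  κ ℕ.* σ ℕ.* b ℕ.≤ a
exponent-bound κ {r} {σ} a b σ²≤4r le = ²-cancel-≤ (begin
  κ ℕ.* σ ℕ.* b ℕ.* (κ ℕ.* σ ℕ.* b)                   ≡⟨ tidy κ σ b ⟩
  κ ℕ.* κ ℕ.* (b ℕ.* b) ℕ.* (σ ℕ.* σ)                 ≤⟨ ℕₚ.*-monoʳ-≤ (κ ℕ.* κ ℕ.* (b ℕ.* b)) σ²≤4r ⟩
  κ ℕ.* κ ℕ.* (b ℕ.* b) ℕ.* (4 ℕ.* r)                 ≡⟨ tidy′ κ b r ⟩
  2 ℕ.* κ ℕ.* (2 ℕ.* κ) ℕ.* r ℕ.* (b ℕ.* b)           ≤⟨ ι-cancel-≤ cleared ⟩
  a ℕ.* a                                             ∎)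
  where
  open ℕₚ.≤-Reasoning
  tidy : ∀ κ σ b → κ ℕ.* σ ℕ.* b ℕ.* (κ ℕ.* σ ℕ.* b) ≡ κ ℕ.* κ ℕ.* (b ℕ.* b) ℕ.* (σ ℕ.* σ)
  tidy = solve-∀-ℕ
  tidy′ : ∀ κ b r → κ ℕ.* κ ℕ.* (b ℕ.* b) ℕ.* (4 ℕ.* r) ≡ 2 ℕ.* κ ℕ.* (2 ℕ.* κ) ℕ.* r ℕ.* (b ℕ.* b)
  tidy′ = solve-∀-ℕ
  c : ℕ
  c = 2 ℕ.* κ
  square : ∀ x b → b * b * (x * x) ≡ x * b * (x * b)
  square = solve-∀ ℚ-ring
  cleared : ι (c ℕ.* c ℕ.* r ℕ.* (b ℕ.* b)) ≤ ι (a ℕ.* a)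
  cleared = subst₂ _≤_
    (trans (*-comm (ι b * ι b) ((ℤ.+ c ℚ./ 1) * (ℤ.+ c ℚ./ 1) * (ℤ.+ r ℚ./ 1)))
      (trans (cong₂ (λ u v → u * u * v * (ι b * ι b)) (sym (ι≡/1 c)) (sym (ι≡/1 r)))
        (sym (trans (ι-* (c ℕ.* c ℕ.* r) (b ℕ.* b)) (cong₂ _*_
          (trans (ι-* (c ℕ.* c) r) (cong (_* ι r) (ι-* c c))) (ι-* b b))))))
    (trans (square (ℤ.+ a ℚ./ b) (ι b)) (trans (cong (λ u → u * u) (/-ι a b)) (sym (ι-* a a))))
    (*-monoˡ (0≤² (ι b)) le)

half-density : ∀ {n} .{{_ : ℕ.NonZero n}} (M : BinMatrix n) → p M ≤ ½ → 2 ℕ.* ones M ℕ.≤ n ℕ.* n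
half-density {n} M p≤½ = ι-cancel-≤ (subst₂ _≤_
  (trans (*-assoc (ι 2) (ι (n ℕ.* n)) (p M)) (trans (cong (ι 2 *_) (trans (*-comm (ι (n ℕ.* n)) (p M))
    (/-ι (ones M) (n ℕ.* n) {{ℕₚ.m*n≢0 n n}}))) (sym (ι-* 2 (ones M)))))
  (halve (ι (n ℕ.* n)))
  (*-monoˡ (0≤* (0≤ι 2) (0≤ι (n ℕ.* n))) p≤½))
  where
  halve : ∀ s → ι 2 * s * ½ ≡ s
  halve = solve-∀ ℚ-ring

-- ⌊√r⌋ + 1 is at most 2⌊√r⌋ because r ≥ 1. The successor form makes it visibly nonzero.
sqrt-up : ∀ r .{{_ : ℕ.NonZero r}} → ∃[ τ ] (r ℕ.≤ suc τ ℕ.* suc τ × suc τ ℕ.* suc τ ℕ.≤ 4 ℕ.* r)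
sqrt-up r with sqrt r
... | zero  , _    , r<1   = ⊥-elim (ℕₚ.<-irrefl refl (ℕₚ.<-≤-trans r<1 (ℕ.>-nonZero⁻¹ r)))
... | suc τ , τ²≤r , r<τ⁺² = suc τ , ℕₚ.<⇒≤ r<τ⁺² ,
  ℕₚ.≤-trans (ℕₚ.*-mono-≤ σ≤2τ σ≤2τ) (ℕₚ.≤-trans (ℕₚ.≤-reflexive (square (suc τ))) (ℕₚ.*-monoʳ-≤ 4 τ²≤r))
  where
  σ≤2τ : suc (suc τ) ℕ.≤ suc τ ℕ.+ suc τ
  σ≤2τ = ℕₚ.+-monoˡ-≤ (suc τ) (ℕ.s≤s ℕ.z≤n)
  square : ∀ t → (t ℕ.+ t) ℕ.* (t ℕ.+ t) ≡ 4 ℕ.* (t ℕ.* t)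
  square = solve-∀-ℕ

edges≡ones : ∀ {n} (M : BinMatrix n) → Edges.edges M (allFin n) (allFin n) ≡ ones M
edges≡ones {n} M = trans (sumL-tabulate (λ i → i) (λ i → sumL (bit i) (allFin n)))
  (sumℕ-cong (λ i → sumL-tabulate (λ j → j) (bit i)))
  where
  open Edges M
  open import Algebra.Properties.Monoid.Sum ℕₚ.+-0-monoid using () renaming (sum-cong-≗ to sumℕ-cong)

-- The induction starts at a density that is a rational square not below 1/2, namely (3/4)². Taking
-- Q = 4h makes q = 3Q/4 = 3h an integer; one factor n of the area bound cancels.
zero-square-size : ∀ {n} .{{_ : ℕ.NonZero n}} (M : BinMatrix n) {k z} → IsRank M k → IsZ M z → 2 ℕ.* ones M ℕ.≤ n ℕ.* n →
  ∀ r .{{_ : ℕ.NonZero r}} σ .{{_ : ℕ.NonZero σ}} h → k ℕ.≤ r → r ℕ.≤ σ ℕ.* σ → 5760 ℕ.* σ ℕ.≤ 4 ℕ.* h →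
  n ℕ.≤ z ℕ.* 2 ℕ.^ suc (3 ℕ.* h)
zero-square-size {n} M {k} {z} isRank isZ half r σ h k≤r r≤σ² σ≪Q = ℕₚ.*-cancelˡ-≤ n (begin
  n ℕ.* n                                  ≡⟨ cong (λ l → l ℕ.* l) (length-tabulate {n = n} (λ i → i)) ⟨
  length (allFin n) ℕ.* length (allFin n)  ≤⟨ bounded ⟩
  2 ℕ.^ suc q ℕ.* (n ℕ.* z)                ≡⟨ regroup (2 ℕ.^ suc q) n z ⟩
  n ℕ.* (z ℕ.* 2 ℕ.^ suc q)                ∎)
  where
  open ℕₚ.≤-Reasoning
  open Edges M
  Q q : ℕ
  Q = 4 ℕ.* h
  q = 3 ℕ.* h
  regroup : ∀ t n z → t ℕ.* (n ℕ.* z) ≡ n ℕ.* (z ℕ.* t)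
  regroup = solve-∀-ℕ
  swap : ∀ h → 4 ℕ.* (3 ℕ.* h) ≡ 3 ℕ.* (4 ℕ.* h)
  swap = solve-∀-ℕ
  quarter : ∀ o h → o ℕ.* (4 ℕ.* h ℕ.* (4 ℕ.* h)) ≡ 8 ℕ.* (h ℕ.* h) ℕ.* (2 ℕ.* o)
  quarter = solve-∀-ℕ
  nine : ∀ h → 9 ℕ.* (h ℕ.* h) ≡ 3 ℕ.* h ℕ.* (3 ℕ.* h)
  nine = solve-∀-ℕ
  sparse : edges (allFin n) (allFin n) ℕ.* (Q ℕ.* Q) ℕ.≤ q ℕ.* q ℕ.* (length (allFin n) ℕ.* length (allFin n))
  sparse = subst (λ l → edges (allFin n) (allFin n) ℕ.* (Q ℕ.* Q) ℕ.≤ q ℕ.* q ℕ.* (l ℕ.* l)) (sym (length-tabulate {n = n} (λ i → i)))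
    (begin
      edges (allFin n) (allFin n) ℕ.* (Q ℕ.* Q)   ≡⟨ cong (ℕ._* (Q ℕ.* Q)) (edges≡ones M) ⟩
      ones M ℕ.* (Q ℕ.* Q)                        ≡⟨ quarter (ones M) h ⟩
      8 ℕ.* (h ℕ.* h) ℕ.* (2 ℕ.* ones M)          ≤⟨ ℕₚ.*-mono-≤ (ℕₚ.m≤n+m (8 ℕ.* (h ℕ.* h)) (h ℕ.* h)) half ⟩
      9 ℕ.* (h ℕ.* h) ℕ.* (n ℕ.* n)               ≡⟨ cong (ℕ._* (n ℕ.* n)) (nine h) ⟩
      q ℕ.* q ℕ.* (n ℕ.* n)                       ∎)
  bounded : length (allFin n) ℕ.* length (allFin n) ℕ.≤ 2 ℕ.^ suc q ℕ.* (n ℕ.* z)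
  bounded = Rectangles.bounded M (elements (proj₁ (proj₁ isRank))) (entry M) (rows-spanned M k isRank)
    r (ℕₚ.≤-trans (ℕₚ.≤-reflexive (trans (length-elements (proj₁ (proj₁ isRank))) (proj₁ (proj₂ (proj₁ isRank))))) k≤r)
    σ r≤σ² Q σ≪Q (allFin n) (allFin n) n z
    (ℕₚ.≤-reflexive (length-tabulate (λ i → i))) (ℕₚ.≤-reflexive (length-tabulate (λ i → i)))
    (zero-rectangle M isZ) q (ℕₚ.≤-reflexive (swap h)) (allFin n) (allFin n) ⊆-refl ⊆-refl sparse

root-bound : ∀ κ {r σ n z} → σ ℕ.* σ ℕ.≤ 4 ℕ.* r → n ℕ.≤ z ℕ.* 2 ℕ.^ (κ ℕ.* σ) → z ≥ n /2^[ ℤ.+ (2 ℕ.* κ) ℚ./ 1 √ r ]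
root-bound κ {r} {σ} {n} {z} σ²≤4r n≤ a b c²r≤ = begin
  n ℕ.^ b                                ≤⟨ ℕₚ.^-monoˡ-≤ b n≤ ⟩
  (z ℕ.* 2 ℕ.^ (κ ℕ.* σ)) ℕ.^ b          ≡⟨ ^-distribʳ-* b z (2 ℕ.^ (κ ℕ.* σ)) ⟩
  z ℕ.^ b ℕ.* (2 ℕ.^ (κ ℕ.* σ)) ℕ.^ b    ≡⟨ cong (z ℕ.^ b ℕ.*_) (ℕₚ.^-*-assoc 2 (κ ℕ.* σ) b) ⟩
  z ℕ.^ b ℕ.* 2 ℕ.^ (κ ℕ.* σ ℕ.* b)      ≤⟨ ℕₚ.*-monoʳ-≤ (z ℕ.^ b) (ℕₚ.^-monoʳ-≤ 2 (exponent-bound κ {r} {σ} a b σ²≤4r c²r≤)) ⟩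
  z ℕ.^ b ℕ.* 2 ℕ.^ a                    ∎
  where open ℕₚ.≤-Reasoning

-- With σ = ⌊√r⌋ + 1 ≤ 2√r and Q = 4gσ, the exponent ¾Q + 1 is at most κσ ≤ 2κ√r.
zero-square-large : ∀ κ g → (∀ σ → 5760 ℕ.* σ ℕ.≤ 4 ℕ.* (g ℕ.* σ)) →
  (∀ σ .{{_ : ℕ.NonZero σ}} → suc (3 ℕ.* (g ℕ.* σ)) ℕ.≤ κ ℕ.* σ) →
  ∀ r .{{_ : ℕ.NonZero r}} n .{{_ : ℕ.NonZero n}} (M : BinMatrix n) {k z} →
  IsRank M k → k ℕ.≤ r → p M ≤ ½ → IsZ M z → z ≥ n /2^[ ℤ.+ (2 ℕ.* κ) ℚ./ 1 √ r ]
zero-square-large κ g g-large κ-large r n M {z = z} isRank k≤r p≤½ isZ =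
  let τ , r≤σ² , σ²≤4r = sqrt-up r in
  root-bound κ {r} {suc τ} {n} {z} σ²≤4r (ℕₚ.≤-trans
    (zero-square-size M isRank isZ (half-density M p≤½) r (suc τ) (g ℕ.* suc τ) k≤r r≤σ² (g-large (suc τ)))
    (ℕₚ.*-monoʳ-≤ z (ℕₚ.^-monoʳ-≤ 2 (κ-large (suc τ)))))

theorem4p2 : Σ[ c ∈ ℚ ] (0ℚ ℚ.< c ×
    ((r : ℕ) .{{_ : ℕ.NonZero r}} (n : ℕ) .{{_ : ℕ.NonZero n}} (M : BinMatrix n) →
    (∃[ k ] (IsRank M k × k ℕ.≤ r)) →
    p M ℚ.≤ ½ →
    ∃[ z ] (IsZ M z × z ≥ n /2^[ c √ r ])))
theorem4p2 = ℤ.+ (2 ℕ.* 5000) ℚ./ 1 , positive⁻¹ (ℤ.+ (2 ℕ.* 5000) ℚ./ 1) , λ r n M (k , isRank , k≤r) p≤½ →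
  let z , isZ = z-exists M in
  -- 1440 = 5760/4. The exponent is 3 · 1440σ + 1 ≤ 4321σ as σ ≥ 1, and 5000 rounds this up.
  z , isZ , zero-square-large 5000 1440
    (λ σ → ℕₚ.≤-reflexive (ℕₚ.*-assoc 4 1440 σ))
    (λ σ → ℕₚ.≤-trans (ℕₚ.+-mono-≤ (ℕ.>-nonZero⁻¹ σ) (ℕₚ.≤-reflexive (sym (ℕₚ.*-assoc 3 1440 σ))))
      (ℕₚ.*-monoˡ-≤ σ {4321} {5000} (ℕₚ.≤ᵇ⇒≤ 4321 5000 _)))
    r n M isRank k≤r p≤½ isZ
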